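{- For every integer $n\ge2$, the oriented skew $(\mathbb{Z}/n\mathbb{Z})$-circulant corresponding to the transitive tournament on $n$ vertices, i.e. the oriented graph with $n\times n$ Hermitian adjacency matrix $B$ given by $B_{j,k}=-i$ for $j<k$, $B_{j,k}=i$ for $j>k$ and $B_{j,j}=0$, has average uniform mixing: its average mixing matrix equals $\frac1nJ_n$.
   Context: A skew-circulant matrix with first row $(a_0,\dots,a_{n-1})$ is $\sum_{j=0}^{n-1}a_jP^j$, where $P$ maps $e_j$ to $e_{j-1}$ for $1\le j\le n-1$ and $e_0$ to $-e_{n-1}$. The matrix $B$ is $-i$ times the skew-circulant matrix with first row $(0,1,1,\dots,1)$. For a graph $X$ of order $n$ with Hermitian adjacency matrix $B$, let $U_X(t)=e^{ -itB}$ and $M_X(t)=U_X(t)\circ\overline{U_X(t)}$ (entrywise product). The average mixing matrix is $\widehat{M}_X=\lim_{T\to\infty}\frac1T\int_0^TM_X(t)\,dt$. $X$ has average uniform mixing if $\widehat{M}_X=\frac1nJ_n$, where $J_n$ is the all-one matrix. -}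

module Defs where

open import Data.Fin.Base as Fin using (Fin; fromℕ; inject₁)
open import Data.Fin.Properties as Fin using (nonZeroIndex)
open import Data.Integer.Base as ℤ using ()
open import Data.Nat.Base as ℕ using (ℕ; zero; suc; _!)
open import Data.Nat.Properties as ℕ using (_!≢0)
open import Data.Product.Base using (∃; _×_; _,_)
open import Data.Rational.Base as ℚ using (ℚ; 0ℚ; 1ℚ; ½; ∣_∣)
open import Data.Rational.Properties as ℚ using ()
open import Data.Rational.Solver using (module +-*-Solver)
open import Data.Vec.Functional using (foldr)
open import Relation.Binary.Definitions using (tri<; tri≈; tri>)
open import Relation.Binary.PropositionalEquality
  using (_≡_; refl; sym; trans; cong; cong₂; subst)
open import Relation.Nullary.Decidable.Core using (yes; no)
open import Relation.Nullary.Negation.Core using (contradiction)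

Eventually : (ℕ → Set) → Set
Eventually P = ∃ λ N → ∀ n → N ℕ.≤ n → P n

IsCauchy : (ℕ → ℚ) → Set
IsCauchy x = ∀ ε → 0ℚ ℚ.< ε →
  ∃ λ N → ∀ m n → N ℕ.≤ m → N ℕ.≤ n → ∣ x m ℚ.- x n ∣ ℚ.≤ ε

-- Equality of reals is _≈ℝ_, not _≡_.
record ℝ : Set where
  constructor mkℝ
  field
    seq    : ℕ → ℚ
    cauchy : IsCauchy seq

open ℝ public

infix 4 _≤ℝ_ _<ℝ_ _≈ℝ_

_≤ℝ_ : ℝ → ℝ → Set
x ≤ℝ y = ∀ ε → 0ℚ ℚ.< ε → Eventually λ n → seq x n ℚ.≤ seq y n ℚ.+ ε

_<ℝ_ : ℝ → ℝ → Set
x <ℝ y = ∃ λ ε → 0ℚ ℚ.< ε × Eventually λ n → seq x n ℚ.+ ε ℚ.≤ seq y n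

_≈ℝ_ : ℝ → ℝ → Set
x ≈ℝ y = x ≤ℝ y × y ≤ℝ x

half+half : ∀ ε → ε ℚ.* ½ ℚ.+ ε ℚ.* ½ ≡ ε
half+half ε = trans (sym (ℚ.*-distribˡ-+ ε ½ ½)) (ℚ.*-identityʳ ε)

ℚ-*-pos : ∀ {p q} → 0ℚ ℚ.< p → 0ℚ ℚ.< q → 0ℚ ℚ.< p ℚ.* q
ℚ-*-pos {p} {q} 0<p 0<q = ℚ.positive⁻¹ (p ℚ.* q)
  {{ℚ.pos*pos⇒pos p {{ℚ.positive 0<p}} q {{ℚ.positive 0<q}}}}

half-pos : ∀ {ε} → 0ℚ ℚ.< ε → 0ℚ ℚ.< ε ℚ.* ½
half-pos 0<ε = ℚ-*-pos 0<ε (ℚ.positive⁻¹ ½)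

ℚ-*-mono-≤ : ∀ {p q r s} → 0ℚ ℚ.≤ r → 0ℚ ℚ.≤ q →
             p ℚ.≤ q → r ℚ.≤ s → p ℚ.* r ℚ.≤ q ℚ.* s
ℚ-*-mono-≤ {p} {q} {r} {s} 0≤r 0≤q p≤q r≤s = ℚ.≤-trans
  (ℚ.*-monoʳ-≤-nonNeg r {{ℚ.nonNegative 0≤r}} p≤q)
  (ℚ.*-monoˡ-≤-nonNeg q {{ℚ.nonNegative 0≤q}} r≤s)

-- A total reciprocal on ℚ, so that reciprocals can be taken termwise.
recip : ℚ → ℚ
recip q with q ℚ.≟ 0ℚ
... | yes _   = 0ℚ
... | no q≢0 = ℚ.1/_ q {{ℚ.≢-nonZero q≢0}}

*-recip : ∀ {q} → 0ℚ ℚ.< q → q ℚ.* recip q ≡ 1ℚ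
*-recip {q} 0<q with q ℚ.≟ 0ℚ
... | yes q≡0 = contradiction (sym q≡0) (ℚ.<⇒≢ 0<q)
... | no q≢0 = ℚ.*-inverseʳ q {{ℚ.≢-nonZero q≢0}}

recip-pos : ∀ {q} → 0ℚ ℚ.< q → 0ℚ ℚ.< recip q
recip-pos {q} 0<q with q ℚ.≟ 0ℚ
... | yes q≡0 = contradiction (sym q≡0) (ℚ.<⇒≢ 0<q)
... | no q≢0 = ℚ.positive⁻¹ _ {{ℚ.1/pos⇒pos q {{ℚ.positive 0<q}}}}

fromℚ : ℚ → ℝ
fromℚ q .seq _ = q
fromℚ q .cauchy ε 0<ε = 0 , λ _ _ _ _ →
  ℚ.≤-trans (ℚ.≤-reflexive (cong ∣_∣ (ℚ.+-inverseʳ q))) (ℚ.<⇒≤ 0<ε)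

0ℝ 1ℝ : ℝ
0ℝ = fromℚ 0ℚ
1ℝ = fromℚ 1ℚ

infixl 6 _+ℝ_ _-ℝ_
infixl 7 _*ℝ_
infix  8 -ℝ_

_+ℝ_ : ℝ → ℝ → ℝ
(x +ℝ y) .seq n = seq x n ℚ.+ seq y n
(x +ℝ y) .cauchy ε 0<ε
  with cauchy x (ε ℚ.* ½) (half-pos 0<ε) | cauchy y (ε ℚ.* ½) (half-pos 0<ε)
... | N , hx | M , hy = N ℕ.⊔ M , λ m n m≥ n≥ → begin
  ∣ (seq x m ℚ.+ seq y m) ℚ.- (seq x n ℚ.+ seq y n) ∣
    ≡⟨ cong ∣_∣ (rearrange (seq x m) (seq y m) (seq x n) (seq y n)) ⟩
  ∣ (seq x m ℚ.- seq x n) ℚ.+ (seq y m ℚ.- seq y n) ∣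
    ≤⟨ ℚ.∣p+q∣≤∣p∣+∣q∣ (seq x m ℚ.- seq x n) (seq y m ℚ.- seq y n) ⟩
  ∣ seq x m ℚ.- seq x n ∣ ℚ.+ ∣ seq y m ℚ.- seq y n ∣
    ≤⟨ ℚ.+-mono-≤ (hx m n (ℕ.m⊔n≤o⇒m≤o N M m≥) (ℕ.m⊔n≤o⇒m≤o N M n≥))
                  (hy m n (ℕ.m⊔n≤o⇒n≤o N M m≥) (ℕ.m⊔n≤o⇒n≤o N M n≥)) ⟩
  ε ℚ.* ½ ℚ.+ ε ℚ.* ½
    ≡⟨ half+half ε ⟩
  ε ∎
  where
  open ℚ.≤-Reasoning
  rearrange : ∀ a b c d →
    (a ℚ.+ b) ℚ.- (c ℚ.+ d) ≡ (a ℚ.- c) ℚ.+ (b ℚ.- d)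
  rearrange = solve 4
    (λ a b c d → (a :+ b) :- (c :+ d) := (a :- c) :+ (b :- d)) refl
    where open +-*-Solver

-ℝ_ : ℝ → ℝ
(-ℝ x) .seq n = ℚ.- seq x n
(-ℝ x) .cauchy ε 0<ε with cauchy x ε 0<ε
... | N , hx = N , λ m n m≥ n≥ →
  subst (ℚ._≤ ε)
    (trans (sym (ℚ.∣-p∣≡∣p∣ (seq x m ℚ.- seq x n)))
           (cong ∣_∣ (ℚ.neg-distrib-+ (seq x m) (ℚ.- seq x n))))
    (hx m n m≥ n≥)

_-ℝ_ : ℝ → ℝ → ℝ
x -ℝ y = x +ℝ (-ℝ y)

bounded : ∀ x → ∃ λ K → 0ℚ ℚ.< K × Eventually λ n → ∣ seq x n ∣ ℚ.≤ K
bounded x with cauchy x 1ℚ (ℚ.positive⁻¹ 1ℚ)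
... | N , hx = 1ℚ ℚ.+ ∣ seq x N ∣
  , ℚ.+-mono-<-≤ (ℚ.positive⁻¹ 1ℚ) (ℚ.0≤∣p∣ (seq x N))
  , N , λ n n≥ → begin
    ∣ seq x n ∣
      ≡⟨ cong ∣_∣ (split (seq x n) (seq x N)) ⟩
    ∣ (seq x n ℚ.- seq x N) ℚ.+ seq x N ∣
      ≤⟨ ℚ.∣p+q∣≤∣p∣+∣q∣ (seq x n ℚ.- seq x N) (seq x N) ⟩
    ∣ seq x n ℚ.- seq x N ∣ ℚ.+ ∣ seq x N ∣
      ≤⟨ ℚ.+-monoˡ-≤ ∣ seq x N ∣ (hx n N n≥ ℕ.≤-refl) ⟩
    1ℚ ℚ.+ ∣ seq x N ∣ ∎
  where
  open ℚ.≤-Reasoning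
  split : ∀ a b → a ≡ (a ℚ.- b) ℚ.+ b
  split = solve 2 (λ a b → a := (a :- b) :+ b) refl
    where open +-*-Solver

split-error : ∀ {K L ε} → 0ℚ ℚ.< K → 0ℚ ℚ.< L → 0ℚ ℚ.< ε →
              ∃ λ δ → 0ℚ ℚ.< δ × K ℚ.* δ ℚ.+ δ ℚ.* L ≡ ε
split-error {K} {L} {ε} 0<K 0<L 0<ε =
  ε ℚ.* recip (K ℚ.+ L) , ℚ-*-pos 0<ε (recip-pos 0<K+L) ,
  trans (collect K L ε (recip (K ℚ.+ L)))
    (trans (cong (ε ℚ.*_) (*-recip 0<K+L)) (ℚ.*-identityʳ ε))
  where
  0<K+L = ℚ.+-mono-< 0<K 0<L
  collect : ∀ k l e r →
    k ℚ.* (e ℚ.* r) ℚ.+ (e ℚ.* r) ℚ.* l ≡ e ℚ.* ((k ℚ.+ l) ℚ.* r)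
  collect = solve 4
    (λ k l e r → k :* (e :* r) :+ (e :* r) :* l := e :* ((k :+ l) :* r)) refl
    where open +-*-Solver

product-error : ∀ {K L δ} a b c d → 0ℚ ℚ.< K → 0ℚ ℚ.< δ →
                ∣ a ∣ ℚ.≤ K → ∣ d ∣ ℚ.≤ L → ∣ a ℚ.- c ∣ ℚ.≤ δ → ∣ b ℚ.- d ∣ ℚ.≤ δ →
                ∣ a ℚ.* b ℚ.- c ℚ.* d ∣ ℚ.≤ K ℚ.* δ ℚ.+ δ ℚ.* L
product-error {K} {L} {δ} a b c d 0<K 0<δ a≤K d≤L a-c≤δ b-d≤δ = begin
  ∣ a ℚ.* b ℚ.- c ℚ.* d ∣
    ≡⟨ cong ∣_∣ (rearrange a b c d) ⟩
  ∣ a ℚ.* (b ℚ.- d) ℚ.+ (a ℚ.- c) ℚ.* d ∣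
    ≤⟨ ℚ.∣p+q∣≤∣p∣+∣q∣ (a ℚ.* (b ℚ.- d)) ((a ℚ.- c) ℚ.* d) ⟩
  ∣ a ℚ.* (b ℚ.- d) ∣ ℚ.+ ∣ (a ℚ.- c) ℚ.* d ∣
    ≡⟨ cong₂ ℚ._+_ (ℚ.∣p*q∣≡∣p∣*∣q∣ a (b ℚ.- d)) (ℚ.∣p*q∣≡∣p∣*∣q∣ (a ℚ.- c) d) ⟩
  ∣ a ∣ ℚ.* ∣ b ℚ.- d ∣ ℚ.+ ∣ a ℚ.- c ∣ ℚ.* ∣ d ∣
    ≤⟨ ℚ.+-mono-≤
         (ℚ-*-mono-≤ (ℚ.0≤∣p∣ (b ℚ.- d)) (ℚ.<⇒≤ 0<K) a≤K b-d≤δ)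
         (ℚ-*-mono-≤ (ℚ.0≤∣p∣ d) (ℚ.<⇒≤ 0<δ) a-c≤δ d≤L) ⟩
  K ℚ.* δ ℚ.+ δ ℚ.* L ∎
  where
  open ℚ.≤-Reasoning
  rearrange : ∀ a b c d →
    a ℚ.* b ℚ.- c ℚ.* d ≡ a ℚ.* (b ℚ.- d) ℚ.+ (a ℚ.- c) ℚ.* d
  rearrange = solve 4
    (λ a b c d → a :* b :- c :* d := a :* (b :- d) :+ (a :- c) :* d) refl
    where open +-*-Solver

*-cauchy : ∀ x y → IsCauchy λ n → seq x n ℚ.* seq y n
*-cauchy x y ε 0<ε =
  let K , 0<K , N₁ , bx    = bounded x
      L , 0<L , N₂ , by    = bounded y
      δ , 0<δ , Kδ+δL≡ε    = split-error 0<K 0<L 0<ε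
      N₃ , hx              = cauchy x δ 0<δ
      N₄ , hy              = cauchy y δ 0<δ
      A                    = N₁ ℕ.⊔ N₂
      B                    = N₃ ℕ.⊔ N₄
  in A ℕ.⊔ B , λ m n m≥ n≥ →
    let mA = ℕ.m⊔n≤o⇒m≤o A B m≥ ; mB = ℕ.m⊔n≤o⇒n≤o A B m≥
        nA = ℕ.m⊔n≤o⇒m≤o A B n≥ ; nB = ℕ.m⊔n≤o⇒n≤o A B n≥
    in subst (∣ seq x m ℚ.* seq y m ℚ.- seq x n ℚ.* seq y n ∣ ℚ.≤_) Kδ+δL≡ε
      (product-error (seq x m) (seq y m) (seq x n) (seq y n) 0<K 0<δ
        (bx m (ℕ.m⊔n≤o⇒m≤o N₁ N₂ mA)) (by n (ℕ.m⊔n≤o⇒n≤o N₁ N₂ nA))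
        (hx m n (ℕ.m⊔n≤o⇒m≤o N₃ N₄ mB) (ℕ.m⊔n≤o⇒m≤o N₃ N₄ nB))
        (hy m n (ℕ.m⊔n≤o⇒n≤o N₃ N₄ mB) (ℕ.m⊔n≤o⇒n≤o N₃ N₄ nB)))

_*ℝ_ : ℝ → ℝ → ℝ
(x *ℝ y) .seq n = seq x n ℚ.* seq y n
(x *ℝ y) .cauchy = *-cauchy x y

recip-antimono : ∀ {c q} → 0ℚ ℚ.< c → c ℚ.≤ q → recip q ℚ.≤ recip c
recip-antimono {c} {q} 0<c c≤q = begin
  recip q                      ≡⟨ ℚ.*-identityˡ (recip q) ⟨
  1ℚ ℚ.* recip q               ≡⟨ cong (ℚ._* recip q) (*-recip 0<c) ⟨
  c ℚ.* recip c ℚ.* recip q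
    ≤⟨ ℚ.*-monoʳ-≤-nonNeg (recip q) {{ℚ.nonNegative (ℚ.<⇒≤ (recip-pos 0<q))}}
         (ℚ.*-monoʳ-≤-nonNeg (recip c) {{ℚ.nonNegative (ℚ.<⇒≤ (recip-pos 0<c))}} c≤q) ⟩
  q ℚ.* recip c ℚ.* recip q    ≡⟨ swap q (recip c) (recip q) ⟩
  recip c ℚ.* (q ℚ.* recip q)  ≡⟨ cong (recip c ℚ.*_) (*-recip 0<q) ⟩
  recip c ℚ.* 1ℚ               ≡⟨ ℚ.*-identityʳ (recip c) ⟩
  recip c                      ∎
  where
  open ℚ.≤-Reasoning
  0<q = ℚ.<-≤-trans 0<c c≤q
  swap : ∀ a b d → a ℚ.* b ℚ.* d ≡ b ℚ.* (a ℚ.* d)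
  swap = solve 3 (λ a b d → a :* b :* d := b :* (a :* d)) refl
    where open +-*-Solver

inverse : ∀ x → 0ℝ <ℝ x → ℝ
inverse x _ .seq n = recip (seq x n)
inverse x (c , 0<c , M , c≤x) .cauchy ε 0<ε
  with cauchy x (ε ℚ.* (c ℚ.* c)) (ℚ-*-pos 0<ε (ℚ-*-pos 0<c 0<c))
... | N , hx = N ℕ.⊔ M , λ m n m≥ n≥ →
  estimate (lower m (ℕ.m⊔n≤o⇒n≤o N M m≥)) (lower n (ℕ.m⊔n≤o⇒n≤o N M n≥))
    (hx n m (ℕ.m⊔n≤o⇒m≤o N M n≥) (ℕ.m⊔n≤o⇒m≤o N M m≥))
  where
  lower : ∀ n → M ℕ.≤ n → c ℚ.≤ seq x n
  lower n n≥ = subst (ℚ._≤ seq x n) (ℚ.+-identityˡ c) (c≤x n n≥)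

  estimate : ∀ {a b} → c ℚ.≤ a → c ℚ.≤ b → ∣ b ℚ.- a ∣ ℚ.≤ ε ℚ.* (c ℚ.* c) →
             ∣ recip a ℚ.- recip b ∣ ℚ.≤ ε
  estimate {a} {b} c≤a c≤b b-a≤ = begin
    ∣ recip a ℚ.- recip b ∣
      ≡⟨ cong ∣_∣ (sym (cong₂ ℚ._-_ (trans (cong (recip a ℚ.*_) (*-recip 0<b))
                                          (ℚ.*-identityʳ (recip a)))
                                   (trans (cong (recip b ℚ.*_) (*-recip 0<a))
                                          (ℚ.*-identityʳ (recip b))))) ⟩
    ∣ recip a ℚ.* (b ℚ.* recip b) ℚ.- recip b ℚ.* (a ℚ.* recip a) ∣
      ≡⟨ cong ∣_∣ (factor a b (recip a) (recip b)) ⟩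
    ∣ (b ℚ.- a) ℚ.* (recip a ℚ.* recip b) ∣
      ≡⟨ ℚ.∣p*q∣≡∣p∣*∣q∣ (b ℚ.- a) (recip a ℚ.* recip b) ⟩
    ∣ b ℚ.- a ∣ ℚ.* ∣ recip a ℚ.* recip b ∣
      ≡⟨ cong (∣ b ℚ.- a ∣ ℚ.*_) (ℚ.0≤p⇒∣p∣≡p 0≤rr) ⟩
    ∣ b ℚ.- a ∣ ℚ.* (recip a ℚ.* recip b)
      ≤⟨ ℚ-*-mono-≤ 0≤rr (ℚ.<⇒≤ (ℚ-*-pos 0<ε (ℚ-*-pos 0<c 0<c))) b-a≤
           (ℚ-*-mono-≤ (ℚ.<⇒≤ (recip-pos 0<b)) (ℚ.<⇒≤ (recip-pos 0<c))
             (recip-antimono 0<c c≤a) (recip-antimono 0<c c≤b)) ⟩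
    ε ℚ.* (c ℚ.* c) ℚ.* (recip c ℚ.* recip c)
      ≡⟨ regroup ε c (recip c) ⟩
    ε ℚ.* (c ℚ.* recip c) ℚ.* (c ℚ.* recip c)
      ≡⟨ cong (λ u → ε ℚ.* u ℚ.* u) (*-recip 0<c) ⟩
    ε ℚ.* 1ℚ ℚ.* 1ℚ
      ≡⟨ trans (ℚ.*-identityʳ (ε ℚ.* 1ℚ)) (ℚ.*-identityʳ ε) ⟩
    ε ∎
    where
    open ℚ.≤-Reasoning
    0<a = ℚ.<-≤-trans 0<c c≤a
    0<b = ℚ.<-≤-trans 0<c c≤b
    0≤rr = ℚ.<⇒≤ (ℚ-*-pos (recip-pos 0<a) (recip-pos 0<b))
    factor : ∀ a b r s → r ℚ.* (b ℚ.* s) ℚ.- s ℚ.* (a ℚ.* r) ≡ (b ℚ.- a) ℚ.* (r ℚ.* s)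
    factor = solve 4
      (λ a b r s → r :* (b :* s) :- s :* (a :* r) := (b :- a) :* (r :* s)) refl
      where open +-*-Solver
    regroup : ∀ e c r →
      e ℚ.* (c ℚ.* c) ℚ.* (r ℚ.* r) ≡ e ℚ.* (c ℚ.* r) ℚ.* (c ℚ.* r)
    regroup = solve 3
      (λ e c r → e :* (c :* c) :* (r :* r) := e :* (c :* r) :* (c :* r)) refl
      where open +-*-Solver

record ℂ : Set where
  constructor _+i_
  field
    re im : ℝ

open ℂ public

fromℝ : ℝ → ℂ
fromℝ x = x +i 0ℝ

0ℂ 1ℂ i : ℂ
0ℂ = fromℝ 0ℝ
1ℂ = fromℝ 1ℝ
i  = 0ℝ +i 1ℝ

infixl 6 _+ℂ_ _-ℂ_
infixl 7 _*ℂ_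
infix  8 -ℂ_

_+ℂ_ _*ℂ_ _-ℂ_ : ℂ → ℂ → ℂ
z +ℂ w = (re z +ℝ re w) +i (im z +ℝ im w)
z *ℂ w = (re z *ℝ re w -ℝ im z *ℝ im w) +i (re z *ℝ im w +ℝ im z *ℝ re w)
z -ℂ w = (re z -ℝ re w) +i (im z -ℝ im w)

-ℂ_ conj : ℂ → ℂ
-ℂ z   = (-ℝ re z) +i (-ℝ im z)
conj z = re z +i (-ℝ im z)

-- |z| ≤ ε, squared to avoid a square root; only used for ε > 0.
Modulus≤ : ℚ → ℂ → Set
Modulus≤ ε z = re z *ℝ re z +ℝ im z *ℝ im z ≤ℝ fromℚ (ε ℚ.* ε)

-- Rational ε suffice, as ℝ is Archimedean.
infix 4 _⟶_
_⟶_ : (ℕ → ℂ) → ℂ → Set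
z ⟶ l = ∀ ε → 0ℚ ℚ.< ε → Eventually λ n → Modulus≤ ε (z n -ℂ l)

sumℂ : ∀ {n} → (Fin n → ℂ) → ℂ
sumℂ = foldr _+ℂ_ 0ℂ

record TaggedPartition (a b : ℝ) : Set where
  field
    size       : ℕ
    point      : Fin (suc size) → ℝ
    tag        : Fin size → ℝ
    point-zero : point Fin.zero ≈ℝ a
    point-last : point (fromℕ size) ≈ℝ b
    point≤tag  : ∀ p → point (inject₁ p) ≤ℝ tag p
    tag≤point  : ∀ p → tag p ≤ℝ point (Fin.suc p)

  width : Fin size → ℝ
  width p = point (Fin.suc p) -ℝ point (inject₁ p)

  riemannSum : (ℝ → ℂ) → ℂ
  riemannSum f = sumℂ λ p → f (tag p) *ℂ fromℝ (width p)

open TaggedPartition public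

HasIntegral : (ℝ → ℂ) → ℝ → ℝ → ℂ → Set
HasIntegral f a b I = ∀ ε → 0ℚ ℚ.< ε → ∃ λ δ → 0ℚ ℚ.< δ ×
  ((P : TaggedPartition a b) → (∀ p → width P p ≤ℝ fromℚ δ) →
   Modulus≤ ε (riemannSum P f -ℂ I))

Matrix : ℕ → Set
Matrix n = Fin n → Fin n → ℂ

0ᴹ 1ᴹ : ∀ {n} → Matrix n
0ᴹ j k = 0ℂ
1ᴹ j k with j Fin.≟ k
... | yes _ = 1ℂ
... | no  _ = 0ℂ

infixl 6 _+ᴹ_
infixl 7 _*ᴹ_ _∘ᴹ_
infixr 7 _·_

_+ᴹ_ _*ᴹ_ _∘ᴹ_ : ∀ {n} → Matrix n → Matrix n → Matrix n
(A +ᴹ B) j k = A j k +ℂ B j k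
(A *ᴹ B) j k = sumℂ λ l → A j l *ℂ B l k
(A ∘ᴹ B) j k = A j k *ℂ B j k

_·_ : ∀ {n} → ℂ → Matrix n → Matrix n
(z · A) j k = z *ℂ A j k

conjᴹ : ∀ {n} → Matrix n → Matrix n
conjᴹ A j k = conj (A j k)

infixr 8 _^ᴹ_
_^ᴹ_ : ∀ {n} → Matrix n → ℕ → Matrix n
A ^ᴹ zero  = 1ᴹ
A ^ᴹ suc m = A *ᴹ (A ^ᴹ m)

1/_! : ℕ → ℂ
1/ m ! = fromℝ (fromℚ ((ℤ.+ 1 ℚ./ (m !)) {{m !≢0}}))

expPartialSum : ∀ {n} → Matrix n → ℕ → Matrix n
expPartialSum A zero    = 0ᴹ
expPartialSum A (suc m) = expPartialSum A m +ᴹ 1/ m ! · (A ^ᴹ m)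

IsMatrixExp : ∀ {n} → Matrix n → Matrix n → Set
IsMatrixExp A E = ∀ j k → (λ m → expPartialSum A m j k) ⟶ E j k

-- The exponential, the integral and the limit are unique up to the equality
-- of ℂ, so asking for some U and some values of the integrals is harmless;
-- it makes their existence part of the assertion.
record IsAverageMixingMatrix {n} (B M̂ : Matrix n) : Set where
  field
    U    : ℝ → Matrix n
    isU  : ∀ t → IsMatrixExp ((-ℂ (i *ℂ fromℝ t)) · B) (U t)

  M : ℝ → Matrix n
  M t = U t ∘ᴹ conjᴹ (U t)

  field
    ∫M   : ℝ → Matrix n
    is∫M : ∀ T → 0ℝ <ℝ T → ∀ j k → HasIntegral (λ t → M t j k) 0ℝ T (∫M T j k)

  average : ∀ T → 0ℝ <ℝ T → Matrix n
  average T 0<T = fromℝ (inverse T 0<T) · ∫M T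

  field
    limit : ∀ j k ε → 0ℚ ℚ.< ε → ∃ λ T₀ → ∀ T (0<T : 0ℝ <ℝ T) → T₀ ≤ℝ T →
            Modulus≤ ε (average T 0<T j k -ℂ M̂ j k)

J : ∀ n → Matrix n
J n j k = 1ℂ

1/n·J : ∀ n → Matrix n
1/n·J n j k = (fromℝ (fromℚ ((ℤ.+ 1 ℚ./ n) {{nonZeroIndex j}})) · J n) j k

AverageUniformMixing : ∀ {n} → Matrix n → Set
AverageUniformMixing {n} B = IsAverageMixingMatrix B (1/n·J n)

-- The Hermitian adjacency matrix; it equals -i times the skew-circulant with
-- first row (0, 1, …, 1), since P^k has entries 1 at (j , j + k) and -1 at
-- (j , j + k - n).
transitiveTournament : ∀ n → Matrix n
transitiveTournament n j k with Fin.<-cmp j k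
... | tri< _ _ _ = -ℂ i
... | tri≈ _ _ _ = 0ℂ
... | tri> _ _ _ = i

{-# OPTIONS --safe #-}

module Submission where

-- Let S = -iB, a real skew-symmetric matrix, and let x be a column of
-- U(t) = exp(tS).  Consecutive rows of S differ in two entries only, so x′ = S x
-- gives x_{j+1}′ − x_j′ = x_j + x_{j+1}, and therefore
--
--   x_{j+1}² − x_j² = d/dt ½ (x_{j+1} − x_j)².
--
-- Since Σ x_j² = 1, every x_j² − 1/n is the derivative of a bounded function;
-- hence the integral of x_j² over [0 , T] is T/n up to a bounded error.

open import Defs

open import Algebra.Bundles using (module CommutativeRing)
import Algebra.Properties.CommutativeSemiring.Exp as Exp
import Algebra.Properties.Semiring.Sum as Sum
open import Data.Fin.Base as Fin using (Fin; zero; suc; fromℕ; inject₁)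
open import Data.Fin.Induction using (<-weakInduction)
import Data.Fin.Properties as Fin
import Data.Integer.Base as ℤ
import Data.Integer.Properties as ℤ
open import Data.Nat.Base as ℕ using (ℕ; zero; suc; _≤_; _!)
import Data.Nat.Properties as ℕ
open import Data.Product.Base using (∃; _×_; _,_; proj₁; proj₂)
open import Data.Rational.Base as ℚ
  using (ℚ; 0ℚ; 1ℚ; ½; ∣_∣; _+_; _*_; _-_; -_)
import Data.Rational.Properties as ℚ
open import Data.Rational.Solver using (module +-*-Solver)
import Data.Rational.Unnormalised.Base as ℚᵘ
import Data.Rational.Unnormalised.Properties as ℚᵘ
open import Data.Sum.Base using (inj₁; inj₂)
open import Function.Base using (_∘_)
open import Relation.Binary.Definitions using (tri<; tri≈; tri>)
open import Relation.Binary.PropositionalEquality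
  using (_≡_; _≢_; refl; sym; trans; cong; cong₂; subst; subst₂; module ≡-Reasoning)
open import Relation.Nullary.Decidable.Core using (yes; no)
open import Relation.Nullary.Negation.Core using (contradiction)

open +-*-Solver using (solve; _:=_; _:+_; _:*_; _:-_; :-_; con)
open CommutativeRing ℚ.+-*-commutativeRing using (semiring; commutativeSemiring)
open Exp commutativeSemiring using (_^_; ^-distrib-*)
open Sum semiring
  using (sum; sum-cong-≗; ∑-distrib-+; ∑-comm; *-distribˡ-sum; sum-replicate-zero)

-- Rational estimates

-- The spectral route would diagonalise S, whose eigenvalues are i times distinct cotangents and
-- whose eigenvectors have entries of equal modulus. The identity for consecutive rows replaces
-- trigonometry and eigenspaces by differentiation and telescoping alone. The obstacle is the
-- analysis. Reals are Cauchy sequences with an undecidable order, so the mean value theorem gives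
-- way to derivatives with an explicit quadratic remainder, which add, multiply and sum to integrals
-- by plain estimates. Every entry of exp(tS) is a diagonal sequence: its p-th approximation is the
-- Taylor polynomial with p terms at the p-th approximation of t. All entries share the truncation
-- p. Hence x′ = S x, the vanishing derivative of Σ x_j² and the identity for neighbours hold as
-- exact rational identities at each index, and errors enter only through remainders, tails and the
-- order of the reals. Only Σ x_j² = 1 itself is true merely up to the equality of reals.

ι : ℕ → ℚ
ι n = ℤ.+ n ℚ./ 1

toℚᵘ-ι : ∀ n → ℚ.toℚᵘ (ι n) ℚᵘ.≃ ℚᵘ.mkℚᵘ (ℤ.+ n) 0
toℚᵘ-ι n = ℚ.toℚᵘ-fromℚᵘ (ℚᵘ.mkℚᵘ (ℤ.+ n) 0)

ι-mono-≤ : ∀ {m n} → m ≤ n → ι m ℚ.≤ ι n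
ι-mono-≤ {m} {n} m≤n = ℚ.toℚᵘ-cancel-≤
  (ℚᵘ.≤-respˡ-≃ (ℚᵘ.≃-sym (toℚᵘ-ι m)) (ℚᵘ.≤-respʳ-≃ (ℚᵘ.≃-sym (toℚᵘ-ι n))
    (ℚᵘ.*≤* (ℤ.*-monoʳ-≤-nonNeg (ℤ.+ 1) (ℤ.+≤+ m≤n)))))

ι-* : ∀ m n → ι (m ℕ.* n) ≡ ι m * ι n
ι-* m n = ℚ.toℚᵘ-injective (begin
  ℚ.toℚᵘ (ι (m ℕ.* n))                    ≈⟨ toℚᵘ-ι (m ℕ.* n) ⟩
  ℚᵘ.mkℚᵘ (ℤ.+ (m ℕ.* n)) 0               ≡⟨ cong (λ k → ℚᵘ.mkℚᵘ k 0) (ℤ.pos-* m n) ⟩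
  ℚᵘ.mkℚᵘ (ℤ.+ m) 0 ℚᵘ.* ℚᵘ.mkℚᵘ (ℤ.+ n) 0
    ≈⟨ ℚᵘ.*-cong (toℚᵘ-ι m) (toℚᵘ-ι n) ⟨
  ℚ.toℚᵘ (ι m) ℚᵘ.* ℚ.toℚᵘ (ι n)          ≈⟨ ℚ.toℚᵘ-homo-* (ι m) (ι n) ⟨
  ℚ.toℚᵘ (ι m * ι n) ∎)
  where open ℚᵘ.≃-Reasoning

ι-suc : ∀ n → ι (suc n) ≡ 1ℚ + ι n
ι-suc n = ℚ.toℚᵘ-injective (begin
  ℚ.toℚᵘ (ι (suc n))                     ≈⟨ toℚᵘ-ι (suc n) ⟩
  ℚᵘ.mkℚᵘ (ℤ.+ suc n) 0
    ≡⟨ cong (λ k → ℚᵘ.mkℚᵘ (ℤ.+ 1 ℤ.+ k) 0) (ℤ.*-identityʳ (ℤ.+ n)) ⟨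
  ℚᵘ.mkℚᵘ (ℤ.+ 1) 0 ℚᵘ.+ ℚᵘ.mkℚᵘ (ℤ.+ n) 0
    ≈⟨ ℚᵘ.+-congʳ (ℚᵘ.mkℚᵘ (ℤ.+ 1) 0) (toℚᵘ-ι n) ⟨
  ℚ.toℚᵘ 1ℚ ℚᵘ.+ ℚ.toℚᵘ (ι n)            ≈⟨ ℚ.toℚᵘ-homo-+ 1ℚ (ι n) ⟨
  ℚ.toℚᵘ (1ℚ + ι n) ∎)
  where open ℚᵘ.≃-Reasoning

ι-*-1/ : ∀ d .{{_ : ℕ.NonZero d}} → ι d * (ℤ.+ 1 ℚ./ d) ≡ 1ℚ
ι-*-1/ d@(suc d-1) = ℚ.toℚᵘ-injective (begin
  ℚ.toℚᵘ (ι d * (ℤ.+ 1 ℚ./ d))                 ≈⟨ ℚ.toℚᵘ-homo-* (ι d) (ℤ.+ 1 ℚ./ d) ⟩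
  ℚ.toℚᵘ (ι d) ℚᵘ.* ℚ.toℚᵘ (ℤ.+ 1 ℚ./ d)
    ≈⟨ ℚᵘ.*-cong (toℚᵘ-ι d) (ℚ.toℚᵘ-fromℚᵘ (ℚᵘ.mkℚᵘ (ℤ.+ 1) d-1)) ⟩
  ℚᵘ.mkℚᵘ (ℤ.+ d) 0 ℚᵘ.* ℚᵘ.mkℚᵘ (ℤ.+ 1) d-1   ≈⟨ ℚᵘ.*≡* d*1*1≡1*[1*d] ⟩
  ℚᵘ.mkℚᵘ (ℤ.+ 1) 0 ∎)
  where
  open ℚᵘ.≃-Reasoning
  d*1*1≡1*[1*d] : ℤ.+ d ℤ.* ℤ.+ 1 ℤ.* ℤ.+ 1 ≡ ℤ.+ 1 ℤ.* (ℤ.+ (1 ℕ.* d))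
  d*1*1≡1*[1*d] = trans (ℤ.*-identityʳ (ℤ.+ d ℤ.* ℤ.+ 1)) (trans (ℤ.*-identityʳ (ℤ.+ d))
    (sym (trans (ℤ.*-identityˡ (ℤ.+ (1 ℕ.* d))) (cong ℤ.+_ (ℕ.*-identityˡ d)))))

-- The absolute value of the numerator serves as m, since the denominator is at least 1.
archimedean : ∀ q → ∃ λ m → q ℚ.≤ ι m
archimedean q@(ℚ.mkℚ n d-1 _) = ℤ.∣ n ∣ , ℚ.toℚᵘ-cancel-≤
  (ℚᵘ.≤-respʳ-≃ (ℚᵘ.≃-sym (toℚᵘ-ι ℤ.∣ n ∣)) (ℚᵘ.*≤* (begin
    n ℤ.* ℤ.+ 1                   ≡⟨ ℤ.*-identityʳ n ⟩
    n                             ≤⟨ i≤∣i∣ n ⟩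
    ℤ.+ ℤ.∣ n ∣                   ≡⟨ ℤ.*-identityʳ (ℤ.+ ℤ.∣ n ∣) ⟨
    ℤ.+ ℤ.∣ n ∣ ℤ.* ℤ.+ 1         ≤⟨ ℤ.*-monoˡ-≤-nonNeg (ℤ.+ ℤ.∣ n ∣) (ℤ.+≤+ (ℕ.s≤s ℕ.z≤n)) ⟩
    ℤ.+ ℤ.∣ n ∣ ℤ.* ℤ.+ suc d-1   ∎)))
  where
  open ℤ.≤-Reasoning
  i≤∣i∣ : ∀ i → i ℤ.≤ ℤ.+ ℤ.∣ i ∣
  i≤∣i∣ (ℤ.+ n)    = ℤ.≤-refl
  i≤∣i∣ ℤ.-[1+ n ] = ℤ.-≤+

0≤1 : 0ℚ ℚ.≤ 1ℚ
0≤1 = ℚ.<⇒≤ (ℚ.positive⁻¹ 1ℚ)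

0≤½ : 0ℚ ℚ.≤ ½
0≤½ = ℚ.<⇒≤ (ℚ.positive⁻¹ ½)

0≤+ : ∀ {p q} → 0ℚ ℚ.≤ p → 0ℚ ℚ.≤ q → 0ℚ ℚ.≤ p + q
0≤+ = ℚ.+-mono-≤

0≤* : ∀ {p q} → 0ℚ ℚ.≤ p → 0ℚ ℚ.≤ q → 0ℚ ℚ.≤ p * q
0≤* {p} {q} 0≤p 0≤q = subst (ℚ._≤ p * q) (ℚ.*-zeroˡ q)
  (ℚ.*-monoʳ-≤-nonNeg q {{ℚ.nonNegative 0≤q}} 0≤p)

0≤^ : ∀ {p} → 0ℚ ℚ.≤ p → ∀ r → 0ℚ ℚ.≤ p ^ r
0≤^ 0≤p zero    = 0≤1
0≤^ 0≤p (suc r) = 0≤* 0≤p (0≤^ 0≤p r)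

*-monoʳ : ∀ {p q} r → 0ℚ ℚ.≤ r → p ℚ.≤ q → p * r ℚ.≤ q * r
*-monoʳ r 0≤r = ℚ.*-monoʳ-≤-nonNeg r {{ℚ.nonNegative 0≤r}}

*-monoˡ : ∀ {p q} r → 0ℚ ℚ.≤ r → p ℚ.≤ q → r * p ℚ.≤ r * q
*-monoˡ r 0≤r = ℚ.*-monoˡ-≤-nonNeg r {{ℚ.nonNegative 0≤r}}

^-mono-≤ : ∀ {p q} → 0ℚ ℚ.≤ p → p ℚ.≤ q → ∀ r → p ^ r ℚ.≤ q ^ r
^-mono-≤ 0≤p p≤q zero    = ℚ.≤-refl
^-mono-≤ 0≤p p≤q (suc r) =
  ℚ-*-mono-≤ (0≤^ 0≤p r) (ℚ.≤-trans 0≤p p≤q) p≤q (^-mono-≤ 0≤p p≤q r)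

∣^∣ : ∀ p r → ∣ p ^ r ∣ ≡ ∣ p ∣ ^ r
∣^∣ p zero    = refl
∣^∣ p (suc r) = trans (ℚ.∣p*q∣≡∣p∣*∣q∣ p (p ^ r)) (cong (∣ p ∣ *_) (∣^∣ p r))

ι-^ : ∀ m r → ι m ^ r ≡ ι (m ℕ.^ r)
ι-^ m zero    = refl
ι-^ m (suc r) = trans (cong (ι m *_) (ι-^ m r)) (sym (ι-* m (m ℕ.^ r)))

∣∣-*-mono : ∀ {p q a b} → 0ℚ ℚ.≤ a → ∣ p ∣ ℚ.≤ a → ∣ q ∣ ℚ.≤ b → ∣ p * q ∣ ℚ.≤ a * b
∣∣-*-mono {p} {q} {a} {b} 0≤a p≤a q≤b = ℚ.≤-trans (ℚ.≤-reflexive (ℚ.∣p*q∣≡∣p∣*∣q∣ p q))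
  (ℚ-*-mono-≤ (ℚ.0≤∣p∣ q) 0≤a p≤a q≤b)

∣∣-+-mono : ∀ {p q a b} → ∣ p ∣ ℚ.≤ a → ∣ q ∣ ℚ.≤ b → ∣ p + q ∣ ℚ.≤ a + b
∣∣-+-mono {p} {q} p≤a q≤b = ℚ.≤-trans (ℚ.∣p+q∣≤∣p∣+∣q∣ p q) (ℚ.+-mono-≤ p≤a q≤b)

∣p-q∣≡∣q-p∣ : ∀ p q → ∣ p - q ∣ ≡ ∣ q - p ∣
∣p-q∣≡∣q-p∣ p q = trans (sym (ℚ.∣-p∣≡∣p∣ (p - q)))
  (cong ∣_∣ (solve 2 (λ p q → :- (p :- q) := q :- p) refl p q))

p≤∣p∣ : ∀ p → p ℚ.≤ ∣ p ∣
p≤∣p∣ p with ℚ.≤-total 0ℚ p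
... | inj₁ 0≤p = ℚ.≤-reflexive (sym (ℚ.0≤p⇒∣p∣≡p 0≤p))
... | inj₂ p≤0 = ℚ.≤-trans p≤0 (ℚ.0≤∣p∣ p)

½^≤1 : ∀ n → ½ ^ n ℚ.≤ 1ℚ
½^≤1 zero    = ℚ.≤-refl
½^≤1 (suc n) = ℚ.≤-trans (*-monoˡ ½ 0≤½ (½^≤1 n)) (ℚ.<⇒≤ (ℚ.*<* (ℤ.+<+ (ℕ.s≤s (ℕ.s≤s ℕ.z≤n)))))

-- In the induction (n+1)½^(n+1) splits into ½ · ½^n and ½ · n½^n, each at most ½. This gives the
-- decay of ½^n at the explicit rate 1/n.
ι*½^≤1 : ∀ n → ι n * ½ ^ n ℚ.≤ 1ℚ
ι*½^≤1 zero    = 0≤1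
ι*½^≤1 (suc n) = begin
  ι (suc n) * (½ * ½ ^ n)                ≡⟨ cong (_* (½ * ½ ^ n)) (ι-suc n) ⟩
  (1ℚ + ι n) * (½ * ½ ^ n)
    ≡⟨ solve 2 (λ a b → (con 1ℚ :+ a) :* (con ½ :* b) := con ½ :* b :+ con ½ :* (a :* b)) refl (ι n) (½ ^ n) ⟩
  ½ * ½ ^ n + ½ * (ι n * ½ ^ n)
    ≤⟨ ℚ.+-mono-≤ (*-monoˡ ½ 0≤½ (½^≤1 n)) (*-monoˡ ½ 0≤½ (ι*½^≤1 n)) ⟩
  ½ * 1ℚ + ½ * 1ℚ                        ≡⟨⟩
  1ℚ                                     ∎
  where open ℚ.≤-Reasoning

-- From any n ≥ C/ε on, C½^n = ε · (C/ε) · ½^n ≤ ε · n½^n ≤ ε.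
*½^→0 : ∀ C ε → 0ℚ ℚ.< ε → Eventually λ n → C * ½ ^ n ℚ.≤ ε
*½^→0 C ε 0<ε with archimedean (C * recip ε)
... | m , C/ε≤m = m , λ n m≤n → begin
  C * ½ ^ n                      ≡⟨ cong (_* ½ ^ n) (ℚ.*-identityʳ C) ⟨
  C * 1ℚ * ½ ^ n                 ≡⟨ cong (λ u → C * u * ½ ^ n) (*-recip 0<ε) ⟨
  C * (ε * recip ε) * ½ ^ n
    ≡⟨ solve 4 (λ c e r h → c :* (e :* r) :* h := e :* ((c :* r) :* h)) refl C ε (recip ε) (½ ^ n) ⟩
  ε * ((C * recip ε) * ½ ^ n)
    ≤⟨ *-monoˡ ε (ℚ.<⇒≤ 0<ε) (*-monoʳ (½ ^ n) (0≤^ 0≤½ n) (ℚ.≤-trans C/ε≤m (ι-mono-≤ m≤n))) ⟩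
  ε * (ι n * ½ ^ n)              ≤⟨ *-monoˡ ε (ℚ.<⇒≤ 0<ε) (ι*½^≤1 n) ⟩
  ε * 1ℚ                         ≡⟨ ℚ.*-identityʳ ε ⟩
  ε                              ∎
  where open ℚ.≤-Reasoning

-- Power sums over ℚ

partialSum : (ℕ → ℚ) → ℕ → ℚ
partialSum g zero    = 0ℚ
partialSum g (suc p) = partialSum g p + g p

partialSum-cong : ∀ {f g} → (∀ r → f r ≡ g r) → ∀ p → partialSum f p ≡ partialSum g p
partialSum-cong f≗g zero    = refl
partialSum-cong f≗g (suc p) = cong₂ _+_ (partialSum-cong f≗g p) (f≗g p)

-- The combination f - g - k d is a first-order Taylor remainder with increment d. The case d = 0
-- covers plain differences.
partialSum-linear : ∀ {f g k h} d → (∀ r → h r ≡ f r - g r - k r * d) → ∀ p →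
                    partialSum h p ≡ partialSum f p - partialSum g p - partialSum k p * d
partialSum-linear d h≗ zero = solve 1 (λ d → con 0ℚ := con 0ℚ :- con 0ℚ :- con 0ℚ :* d) refl d
partialSum-linear {f} {g} {k} d h≗ (suc p) =
  trans (cong₂ _+_ (partialSum-linear d h≗ p) (h≗ p))
    (solve 7 (λ F G K f g k d →
        (F :- G :- K :* d) :+ (f :- g :- k :* d) := (F :+ f) :- (G :+ g) :- (K :+ k) :* d)
      refl (partialSum f p) (partialSum g p) (partialSum k p) (f p) (g p) (k p) d)

Geometric : ℚ → (ℕ → ℚ) → Set
Geometric C g = ∀ r → ∣ g r ∣ ℚ.≤ C * ½ ^ r

geometric⇒0≤C : ∀ {C g} → Geometric C g → 0ℚ ℚ.≤ C
geometric⇒0≤C {C} {g} geo =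
  ℚ.≤-trans (ℚ.0≤∣p∣ (g 0)) (ℚ.≤-trans (geo 0) (ℚ.≤-reflexive (ℚ.*-identityʳ C)))

-- The second summand is a reserve that makes the induction go through: half of it pays for the next
-- term, and the other half is the new reserve.
partialSum-tail-+ : ∀ {C g} → Geometric C g → ∀ p k →
  ∣ partialSum g (k ℕ.+ p) - partialSum g p ∣ + (C + C) * ½ ^ (k ℕ.+ p) ℚ.≤ (C + C) * ½ ^ p
partialSum-tail-+ {C} {g} geo p zero = ℚ.≤-reflexive (trans
  (cong (λ u → ∣ u ∣ + (C + C) * ½ ^ p) (ℚ.+-inverseʳ (partialSum g p)))
  (ℚ.+-identityˡ ((C + C) * ½ ^ p)))
partialSum-tail-+ {C} {g} geo p (suc k) = begin
  ∣ Σₖ + gₖ - Σ₀ ∣ + (C + C) * (½ * h)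
    ≡⟨ cong (λ u → ∣ u ∣ + (C + C) * (½ * h))
         (solve 3 (λ a b c → a :+ b :- c := (a :- c) :+ b) refl Σₖ gₖ Σ₀) ⟩
  ∣ (Σₖ - Σ₀) + gₖ ∣ + (C + C) * (½ * h)
    ≤⟨ ℚ.+-monoˡ-≤ ((C + C) * (½ * h)) (∣∣-+-mono (ℚ.≤-refl {∣ Σₖ - Σ₀ ∣}) (geo (k ℕ.+ p))) ⟩
  (∣ Σₖ - Σ₀ ∣ + C * h) + (C + C) * (½ * h)
    ≡⟨ solve 3 (λ x c h → (x :+ c :* h) :+ (c :+ c) :* (con ½ :* h) := x :+ (c :+ c) :* h) refl
         ∣ Σₖ - Σ₀ ∣ C h ⟩
  ∣ Σₖ - Σ₀ ∣ + (C + C) * h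
    ≤⟨ partialSum-tail-+ {C} {g} geo p k ⟩
  (C + C) * ½ ^ p ∎
  where
  open ℚ.≤-Reasoning
  Σₖ = partialSum g (k ℕ.+ p)
  Σ₀ = partialSum g p
  gₖ = g (k ℕ.+ p)
  h  = ½ ^ (k ℕ.+ p)

partialSum-tail : ∀ {C g} → Geometric C g → ∀ {p q} → p ≤ q →
                  ∣ partialSum g q - partialSum g p ∣ ℚ.≤ (C + C) * ½ ^ p
partialSum-tail {C} {g} geo {p} {q} p≤q =
  subst (λ q → ∣ partialSum g q - partialSum g p ∣ ℚ.≤ (C + C) * ½ ^ p) (ℕ.m∸n+n≡m p≤q)
    (begin
      ∣ Δ ∣           ≡⟨ ℚ.+-identityʳ ∣ Δ ∣ ⟨
      ∣ Δ ∣ + 0ℚ      ≤⟨ ℚ.+-monoʳ-≤ ∣ Δ ∣ (0≤* (0≤+ 0≤C 0≤C) (0≤^ 0≤½ (q ℕ.∸ p ℕ.+ p))) ⟩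
      ∣ Δ ∣ + (C + C) * ½ ^ (q ℕ.∸ p ℕ.+ p)
                      ≤⟨ partialSum-tail-+ {C} {g} geo p (q ℕ.∸ p) ⟩
      (C + C) * ½ ^ p ∎)
  where
  open ℚ.≤-Reasoning
  Δ = partialSum g (q ℕ.∸ p ℕ.+ p) - partialSum g p
  0≤C = geometric⇒0≤C {C} {g} geo

partialSum-bound : ∀ {C g} → Geometric C g → ∀ p → ∣ partialSum g p ∣ ℚ.≤ C + C
partialSum-bound {C} {g} geo p = begin
  ∣ partialSum g p ∣         ≡⟨ cong ∣_∣ (ℚ.+-identityʳ (partialSum g p)) ⟨
  ∣ partialSum g p - 0ℚ ∣    ≤⟨ partialSum-tail {C} {g} geo {0} {p} ℕ.z≤n ⟩
  (C + C) * 1ℚ               ≡⟨ ℚ.*-identityʳ (C + C) ⟩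
  C + C                      ∎
  where open ℚ.≤-Reasoning

-- Doubling the base absorbs the inhomogeneous term: L(2L)^r + L^r ≤ 2L(2L)^r because L ≥ 1.
-- Differences of powers, their derivatives and their remainders all obey such a recurrence, so the
-- factors r and r² of the usual bounds never appear.
recurrence-bound : ∀ {L D t} {z y : ℕ → ℚ} → 1ℚ ℚ.≤ L → 0ℚ ℚ.≤ D → ∣ t ∣ ℚ.≤ L →
  z 0 ≡ 0ℚ → (∀ r → z (suc r) ≡ t * z r + y r) → (∀ r → ∣ y r ∣ ℚ.≤ L ^ r * D) →
  ∀ r → ∣ z r ∣ ℚ.≤ (L + L) ^ r * D
recurrence-bound {L} {D} 1≤L 0≤D t≤L z₀ zₛ y≤ zero =
  subst (λ u → ∣ u ∣ ℚ.≤ 1ℚ * D) (sym z₀) (0≤* 0≤1 0≤D)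
recurrence-bound {L} {D} {t} {z} {y} 1≤L 0≤D t≤L z₀ zₛ y≤ (suc r) = begin
  ∣ z (suc r) ∣                                  ≡⟨ cong ∣_∣ (zₛ r) ⟩
  ∣ t * z r + y r ∣
    ≤⟨ ∣∣-+-mono (∣∣-*-mono 0≤L t≤L (recurrence-bound {L} {D} {t} {z} {y} 1≤L 0≤D t≤L z₀ zₛ y≤ r)) (y≤ r) ⟩
  L * ((L + L) ^ r * D) + L ^ r * D
    ≤⟨ ℚ.+-monoʳ-≤ (L * ((L + L) ^ r * D)) (*-monoʳ D 0≤D (^-mono-≤ 0≤L L≤L+L r)) ⟩
  L * ((L + L) ^ r * D) + (L + L) ^ r * D
    ≡⟨ cong (L * ((L + L) ^ r * D) +_) (ℚ.*-identityˡ ((L + L) ^ r * D)) ⟨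
  L * ((L + L) ^ r * D) + 1ℚ * ((L + L) ^ r * D)
    ≤⟨ ℚ.+-monoʳ-≤ (L * ((L + L) ^ r * D))
         (*-monoʳ ((L + L) ^ r * D) (0≤* (0≤^ (0≤+ 0≤L 0≤L) r) 0≤D) 1≤L) ⟩
  L * ((L + L) ^ r * D) + L * ((L + L) ^ r * D)
    ≡⟨ solve 3 (λ l w d → l :* (w :* d) :+ l :* (w :* d) := ((l :+ l) :* w) :* d) refl L ((L + L) ^ r) D ⟩
  (L + L) * (L + L) ^ r * D ∎
  where
  open ℚ.≤-Reasoning
  0≤L = ℚ.≤-trans 0≤1 1≤L
  L≤L+L : L ℚ.≤ L + L
  L≤L+L = subst (ℚ._≤ L + L) (ℚ.+-identityʳ L) (ℚ.+-monoʳ-≤ L 0≤L)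

-- This is r s^(r-1), generated by the product rule; it avoids the exponent r - 1 and has the shape
-- that `recurrence-bound` expects.
derivPow : ℚ → ℕ → ℚ
derivPow s zero    = 0ℚ
derivPow s (suc r) = s * derivPow s r + s ^ r

derivPow-suc : ∀ s r → derivPow s (suc r) ≡ ι (suc r) * s ^ r
derivPow-suc s zero    = solve 1 (λ s → s :* con 0ℚ :+ con 1ℚ := con 1ℚ :* con 1ℚ) refl s
derivPow-suc s (suc r) = trans (cong (λ u → s * u + s * s ^ r) (derivPow-suc s r))
  (trans (solve 3 (λ s n w → s :* (n :* w) :+ s :* w := (con 1ℚ :+ n) :* (s :* w)) refl s (ι (suc r)) (s ^ r))
    (cong (_* (s * s ^ r)) (sym (ι-suc (suc r)))))

-- The factor ½ ^ r costs nothing, as Y is arbitrary, and makes every series below geometric.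
Entire : (ℕ → ℚ) → Set
Entire a = ∀ Y → 0ℚ ℚ.≤ Y → ∃ λ C → ∀ r → ∣ a r ∣ * Y ^ r ℚ.≤ C * ½ ^ r

powerSum : (ℕ → ℚ) → ℕ → ℚ → ℚ
powerSum a p t = partialSum (λ r → a r * t ^ r) p

derivCoeff : (ℕ → ℚ) → ℕ → ℚ
derivCoeff a r = ι (suc r) * a (suc r)

-- The base 4L comes from two doublings by `recurrence-bound`: powers are bounded by L^r, their
-- differences and derivatives by multiples of (2L)^r, their quadratic remainders by multiples of
-- (4L)^r.
module PowerSumEstimates {a : ℕ → ℚ} {L C : ℚ} (1≤L : 1ℚ ℚ.≤ L)
  (a≤ : ∀ r → ∣ a r ∣ * (L + L + (L + L)) ^ r ℚ.≤ C * ½ ^ r) where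

  private
    0≤L   = ℚ.≤-trans 0≤1 1≤L
    0≤2L  = 0≤+ 0≤L 0≤L
    p≤p+q : ∀ {p q} → 0ℚ ℚ.≤ q → p ℚ.≤ p + q
    p≤p+q {p} {q} 0≤q = subst (ℚ._≤ p + q) (ℚ.+-identityʳ p) (ℚ.+-monoʳ-≤ p 0≤q)
    L≤2L  = p≤p+q {L} 0≤L
    2L≤4L = p≤p+q {L + L} 0≤2L
    1≤2L  = ℚ.≤-trans 1≤L L≤2L

    weaken : ∀ {Y D z} r → 0ℚ ℚ.≤ Y → Y ℚ.≤ L + L + (L + L) → 0ℚ ℚ.≤ D →
             ∣ z ∣ ℚ.≤ Y ^ r * D → ∣ a r * z ∣ ℚ.≤ (C * D) * ½ ^ r
    weaken {Y} {D} {z} r 0≤Y Y≤4L 0≤D z≤ = begin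
      ∣ a r * z ∣                            ≤⟨ ∣∣-*-mono (ℚ.0≤∣p∣ (a r)) ℚ.≤-refl z≤ ⟩
      ∣ a r ∣ * (Y ^ r * D)
        ≤⟨ *-monoˡ ∣ a r ∣ (ℚ.0≤∣p∣ (a r)) (*-monoʳ D 0≤D (^-mono-≤ 0≤Y Y≤4L r)) ⟩
      ∣ a r ∣ * ((L + L + (L + L)) ^ r * D)  ≡⟨ ℚ.*-assoc ∣ a r ∣ ((L + L + (L + L)) ^ r) D ⟨
      ∣ a r ∣ * (L + L + (L + L)) ^ r * D    ≤⟨ *-monoʳ D 0≤D (a≤ r) ⟩
      C * ½ ^ r * D                          ≡⟨ solve 3 (λ c h d → c :* h :* d := (c :* d) :* h) refl C (½ ^ r) D ⟩
      C * D * ½ ^ r                          ∎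
      where open ℚ.≤-Reasoning

    pow≤ : ∀ {s} → ∣ s ∣ ℚ.≤ L → ∀ r → ∣ s ^ r ∣ ℚ.≤ L ^ r
    pow≤ {s} s≤L r = subst (ℚ._≤ L ^ r) (sym (∣^∣ s r)) (^-mono-≤ (ℚ.0≤∣p∣ s) s≤L r)

    pow≤*1 : ∀ {s} → ∣ s ∣ ℚ.≤ L → ∀ r → ∣ s ^ r ∣ ℚ.≤ L ^ r * 1ℚ
    pow≤*1 {s} s≤L r = subst (∣ s ^ r ∣ ℚ.≤_) (sym (ℚ.*-identityʳ (L ^ r))) (pow≤ s≤L r)

    powDiff≤ : ∀ {s t} → ∣ s ∣ ℚ.≤ L → ∣ t ∣ ℚ.≤ L → ∀ r →
               ∣ t ^ r - s ^ r ∣ ℚ.≤ (L + L) ^ r * ∣ t - s ∣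
    powDiff≤ {s} {t} s≤L t≤L = recurrence-bound {L} {∣ t - s ∣} {t}
      {λ r → t ^ r - s ^ r} {λ r → s ^ r * (t - s)} 1≤L (ℚ.0≤∣p∣ (t - s)) t≤L refl
      (λ r → solve 4 (λ s t x y → t :* x :- s :* y := t :* (x :- y) :+ y :* (t :- s)) refl s t (t ^ r) (s ^ r))
      (λ r → ∣∣-*-mono {s ^ r} {t - s} (0≤^ 0≤L r) (pow≤ s≤L r) ℚ.≤-refl)

    derivPow≤ : ∀ {s} → ∣ s ∣ ℚ.≤ L → ∀ r → ∣ derivPow s r ∣ ℚ.≤ (L + L) ^ r * 1ℚ
    derivPow≤ {s} s≤L = recurrence-bound {L} {1ℚ} {s} {derivPow s} {s ^_} 1≤L 0≤1 s≤L refl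
      (λ r → refl) (pow≤*1 s≤L)

    powRem : ℚ → ℚ → ℕ → ℚ
    powRem s t r = t ^ r - s ^ r - derivPow s r * (t - s)

    -- The remainders satisfy rem(r+1) = t · rem(r) + `derivPow s r` · (t - s)². The inhomogeneous
    -- term already grows like (2L)^r, so the recurrence is applied with 2L as its base.
    powRem≤ : ∀ {s t} → ∣ s ∣ ℚ.≤ L → ∣ t ∣ ℚ.≤ L → ∀ r →
              ∣ powRem s t r ∣ ℚ.≤ (L + L + (L + L)) ^ r * (∣ t - s ∣ * ∣ t - s ∣)
    powRem≤ {s} {t} s≤L t≤L = recurrence-bound {L + L} {∣ t - s ∣ * ∣ t - s ∣} {t}
      {powRem s t} {λ r → derivPow s r * ((t - s) * (t - s))} 1≤2L (0≤* (ℚ.0≤∣p∣ (t - s)) (ℚ.0≤∣p∣ (t - s)))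
      (ℚ.≤-trans t≤L L≤2L)
      (solve 2 (λ s t → con 1ℚ :- con 1ℚ :- con 0ℚ :* (t :- s) := con 0ℚ) refl s t)
      (λ r → solve 5 (λ s t x y e →
          t :* x :- s :* y :- (s :* e :+ y) :* (t :- s)
            := t :* (x :- y :- e :* (t :- s)) :+ e :* ((t :- s) :* (t :- s)))
        refl s t (t ^ r) (s ^ r) (derivPow s r))
      (λ r → ∣∣-*-mono {derivPow s r} (0≤^ 0≤2L r)
        (subst (∣ derivPow s r ∣ ℚ.≤_) (ℚ.*-identityʳ ((L + L) ^ r)) (derivPow≤ s≤L r))
        (ℚ.≤-reflexive (ℚ.∣p*q∣≡∣p∣*∣q∣ (t - s) (t - s))))

  powerTerms-geometric : ∀ {s} → ∣ s ∣ ℚ.≤ L → Geometric C (λ r → a r * s ^ r)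
  powerTerms-geometric {s} s≤L r = subst (λ c → ∣ a r * s ^ r ∣ ℚ.≤ c * ½ ^ r) (ℚ.*-identityʳ C)
    (weaken r 0≤L (ℚ.≤-trans L≤2L 2L≤4L) 0≤1 (pow≤*1 s≤L r))

  powerSum-lipschitz : ∀ {s t} → ∣ s ∣ ℚ.≤ L → ∣ t ∣ ℚ.≤ L → ∀ p →
    ∣ powerSum a p t - powerSum a p s ∣ ℚ.≤ (C + C) * ∣ t - s ∣
  powerSum-lipschitz {s} {t} s≤L t≤L p = begin
    ∣ powerSum a p t - powerSum a p s ∣
      ≡⟨ cong ∣_∣ (trans (solve 2 (λ x y → x :- y := x :- y :- y :* con 0ℚ) refl (powerSum a p t) (powerSum a p s))
           (sym (partialSum-linear {λ r → a r * t ^ r} {λ r → a r * s ^ r} {λ r → a r * s ^ r} 0ℚ (λ r →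
             solve 3 (λ a x y → a :* (x :- y) := a :* x :- a :* y :- a :* y :* con 0ℚ) refl (a r) (t ^ r) (s ^ r)) p))) ⟩
    ∣ partialSum (λ r → a r * (t ^ r - s ^ r)) p ∣
      ≤⟨ partialSum-bound {C * ∣ t - s ∣}
           (λ r → weaken r 0≤2L 2L≤4L (ℚ.0≤∣p∣ (t - s)) (powDiff≤ s≤L t≤L r)) p ⟩
    C * ∣ t - s ∣ + C * ∣ t - s ∣        ≡⟨ ℚ.*-distribʳ-+ ∣ t - s ∣ C C ⟨
    (C + C) * ∣ t - s ∣                  ∎
    where open ℚ.≤-Reasoning

  private
    -- The constant term has derivative 0, so differentiation costs one term of the truncation.
    derivSum : ∀ s p → partialSum (λ r → a r * derivPow s r) (suc p) ≡ powerSum (derivCoeff a) p s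
    derivSum s zero    = solve 1 (λ a → con 0ℚ :+ a :* con 0ℚ := con 0ℚ) refl (a 0)
    derivSum s (suc p) = cong₂ _+_ (derivSum s p) (trans (cong (a (suc p) *_) (derivPow-suc s p))
      (solve 3 (λ a n w → a :* (n :* w) := n :* a :* w) refl (a (suc p)) (ι (suc p)) (s ^ p)))

  -- The derivative series is truncated at the same number of terms as the series itself, although
  -- the derivative of the truncated series has one term less. The surplus last term accounts for
  -- the summand with ½^(p+1).
  powerSum-remainder : ∀ {s t} → ∣ s ∣ ℚ.≤ L → ∣ t ∣ ℚ.≤ L → ∀ p →
    ∣ powerSum a (suc p) t - powerSum a (suc p) s - powerSum (derivCoeff a) (suc p) s * (t - s) ∣
      ℚ.≤ (C + C) * (∣ t - s ∣ * ∣ t - s ∣) + C * ½ ^ suc p * ∣ t - s ∣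
  powerSum-remainder {s} {t} s≤L t≤L p = begin
    ∣ powerSum a (suc p) t - powerSum a (suc p) s - (Dₚ + dₚ) * (t - s) ∣
      ≡⟨ cong ∣_∣ (solve 5 (λ x y D d w →
           x :- y :- (D :+ d) :* w := (x :- y :- D :* w) :+ :- d :* w) refl
             (powerSum a (suc p) t) (powerSum a (suc p) s) Dₚ dₚ (t - s)) ⟩
    ∣ (powerSum a (suc p) t - powerSum a (suc p) s - Dₚ * (t - s)) + - dₚ * (t - s) ∣
      ≡⟨ cong (λ u → ∣ u + - dₚ * (t - s) ∣) (trans
           (cong (λ u → powerSum a (suc p) t - powerSum a (suc p) s - u * (t - s)) (sym (derivSum s p)))
           (sym (partialSum-linear {λ r → a r * t ^ r} {λ r → a r * s ^ r} {λ r → a r * derivPow s r}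
             {λ r → a r * powRem s t r} (t - s) (λ r →
             solve 5 (λ a x y e d → a :* (x :- y :- e :* d) := a :* x :- a :* y :- a :* e :* d) refl
               (a r) (t ^ r) (s ^ r) (derivPow s r) (t - s)) (suc p)))) ⟩
    ∣ partialSum (λ r → a r * powRem s t r) (suc p) + - dₚ * (t - s) ∣
      ≤⟨ ∣∣-+-mono
           (partialSum-bound {C * D²} (λ r → weaken {D = D²} r (0≤+ 0≤2L 0≤2L) ℚ.≤-refl 0≤D² (powRem≤ s≤L t≤L r)) (suc p))
           (∣∣-*-mono {p = - dₚ} {q = t - s}
             (0≤* (geometric⇒0≤C {C} (powerTerms-geometric {s} s≤L)) (0≤^ 0≤½ (suc p)))
             (ℚ.≤-trans (ℚ.≤-reflexive (ℚ.∣-p∣≡∣p∣ dₚ)) dₚ≤) ℚ.≤-refl) ⟩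
    (C * D² + C * D²) + C * ½ ^ suc p * ∣ t - s ∣
      ≡⟨ cong (_+ C * ½ ^ suc p * ∣ t - s ∣) (ℚ.*-distribʳ-+ D² C C) ⟨
    (C + C) * D² + C * ½ ^ suc p * ∣ t - s ∣ ∎
    where
    open ℚ.≤-Reasoning
    Dₚ = powerSum (derivCoeff a) p s
    dₚ = derivCoeff a p * s ^ p
    D² = ∣ t - s ∣ * ∣ t - s ∣
    0≤D² = 0≤* (ℚ.0≤∣p∣ (t - s)) (ℚ.0≤∣p∣ (t - s))
    dₚ≤ : ∣ dₚ ∣ ℚ.≤ C * ½ ^ suc p
    dₚ≤ = begin
      ∣ dₚ ∣    ≡⟨ cong ∣_∣ (trans (solve 3 (λ a n w → n :* a :* w := a :* (n :* w)) refl (a (suc p)) (ι (suc p)) (s ^ p))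
                            (cong (a (suc p) *_) (sym (derivPow-suc s p)))) ⟩
      ∣ a (suc p) * derivPow s (suc p) ∣
                ≤⟨ weaken (suc p) 0≤2L 2L≤4L 0≤1 (derivPow≤ s≤L (suc p)) ⟩
      C * 1ℚ * ½ ^ suc p  ≡⟨ cong (_* ½ ^ suc p) (ℚ.*-identityʳ C) ⟩
      C * ½ ^ suc p       ∎

-- Inequalities between reals

Eventually-map : ∀ {P Q : ℕ → Set} → (∀ n → P n → Q n) → Eventually P → Eventually Q
Eventually-map f (N , p) = N , λ n N≤n → f n (p n N≤n)

Eventually-zip : ∀ {P Q R : ℕ → Set} → (∀ n → P n → Q n → R n) →
                 Eventually P → Eventually Q → Eventually R
Eventually-zip f (N , p) (M , q) = N ℕ.⊔ M , λ n N⊔M≤n →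
  f n (p n (ℕ.m⊔n≤o⇒m≤o N M N⊔M≤n)) (q n (ℕ.m⊔n≤o⇒n≤o N M N⊔M≤n))

infixl 6 _+ᴿ_ _-ᴿ_
infixl 7 _*ᴿ_
infix  8 -ᴿ_

-- ℝ without η: conversion checking then never compares the Cauchy proofs, and
-- the arguments of the operations below can be inferred.
record Real : Set where
  no-eta-equality
  constructor mkReal
  field real : ℝ

  at : ℕ → ℚ
  at = seq real

open Real

ratᴿ : ℚ → Real
ratᴿ q .real = fromℚ q

0ᴿ 1ᴿ : Real
0ᴿ = ratᴿ 0ℚ
1ᴿ = ratᴿ 1ℚ

_+ᴿ_ _*ᴿ_ : Real → Real → Real
(x +ᴿ y) .real = real x +ℝ real y
(x *ᴿ y) .real = real x *ℝ real y

-ᴿ_ : Real → Real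
(-ᴿ x) .real = -ℝ real x

_-ᴿ_ : Real → Real → Real
x -ᴿ y = x +ᴿ (-ᴿ y)

-- Taken termwise, so that the sign of a real never has to be decided.
∣_∣ᴿ : Real → Real
∣ x ∣ᴿ .real .seq n = ∣ at x n ∣
∣ x ∣ᴿ .real .cauchy ε 0<ε = let N , hx = cauchy (real x) ε 0<ε in
  N , λ m n m≥ n≥ → ℚ.≤-trans (reverse-triangle (at x m) (at x n)) (hx m n m≥ n≥)
  where
  half : ∀ p q → ∣ p ∣ - ∣ q ∣ ℚ.≤ ∣ p - q ∣
  half p q = begin
    ∣ p ∣ - ∣ q ∣                  ≡⟨ cong (λ u → ∣ u ∣ - ∣ q ∣) (solve 2 (λ p q → p := (p :- q) :+ q) refl p q) ⟩
    ∣ (p - q) + q ∣ - ∣ q ∣        ≤⟨ ℚ.+-monoˡ-≤ (- ∣ q ∣) (ℚ.∣p+q∣≤∣p∣+∣q∣ (p - q) q) ⟩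
    (∣ p - q ∣ + ∣ q ∣) - ∣ q ∣    ≡⟨ solve 2 (λ a b → (a :+ b) :- b := a) refl ∣ p - q ∣ ∣ q ∣ ⟩
    ∣ p - q ∣                      ∎
    where open ℚ.≤-Reasoning
  reverse-triangle : ∀ p q → ∣ ∣ p ∣ - ∣ q ∣ ∣ ℚ.≤ ∣ p - q ∣
  reverse-triangle p q with ℚ.∣p∣≡p∨∣p∣≡-p (∣ p ∣ - ∣ q ∣)
  ... | inj₁ eq = ℚ.≤-trans (ℚ.≤-reflexive eq) (half p q)
  ... | inj₂ eq = ℚ.≤-trans (ℚ.≤-reflexive (trans eq
      (solve 2 (λ a b → :- (a :- b) := b :- a) refl ∣ p ∣ ∣ q ∣)))
    (ℚ.≤-trans (half q p) (ℚ.≤-reflexive (∣p-q∣≡∣q-p∣ q p)))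

infix 4 _≲_

-- `_≤ℝ_` unfolds to a statement about sequences, from which the two reals cannot be recovered. The
-- record keeps them visible to inference.
record _≲_ (x y : Real) : Set where
  constructor wrap
  field unwrap : real x ≤ℝ real y

open _≲_

p≤p+ε : ∀ {p ε} → 0ℚ ℚ.< ε → p ℚ.≤ p + ε
p≤p+ε {p} {ε} 0<ε = subst (ℚ._≤ p + ε) (ℚ.+-identityʳ p) (ℚ.+-monoʳ-≤ p (ℚ.<⇒≤ 0<ε))

shrink : ∀ {C ε} → 0ℚ ℚ.≤ C → 0ℚ ℚ.< ε → ∃ λ δ → 0ℚ ℚ.< δ × C * δ ℚ.≤ ε
-- The divisor is C + 1 because C may be zero.
shrink {C} {ε} 0≤C 0<ε = ε * recip (C + 1ℚ) , 0<δ , (begin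
  C * (ε * recip (C + 1ℚ))          ≤⟨ *-monoʳ (ε * recip (C + 1ℚ)) (ℚ.<⇒≤ 0<δ) (p≤p+ε {C} (ℚ.positive⁻¹ 1ℚ)) ⟩
  (C + 1ℚ) * (ε * recip (C + 1ℚ))
    ≡⟨ solve 3 (λ c e r → c :* (e :* r) := e :* (c :* r)) refl (C + 1ℚ) ε (recip (C + 1ℚ)) ⟩
  ε * ((C + 1ℚ) * recip (C + 1ℚ))   ≡⟨ cong (ε *_) (*-recip 0<C+1) ⟩
  ε * 1ℚ                            ≡⟨ ℚ.*-identityʳ ε ⟩
  ε                                 ∎)
  where
  open ℚ.≤-Reasoning
  0<C+1 = ℚ.+-mono-≤-< 0≤C (ℚ.positive⁻¹ 1ℚ)
  0<δ   = ℚ-*-pos 0<ε (recip-pos 0<C+1)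

pointwise-≲ : ∀ {x y} → (∀ n → at x n ℚ.≤ at y n) → x ≲ y
pointwise-≲ x≤y = wrap λ ε 0<ε → 0 , λ n _ → ℚ.≤-trans (x≤y n) (p≤p+ε 0<ε)

≗⇒≲ : ∀ {x y} → (∀ n → at x n ≡ at y n) → x ≲ y
≗⇒≲ x≗y = pointwise-≲ λ n → ℚ.≤-reflexive (x≗y n)

≲-refl : ∀ {x} → x ≲ x
≲-refl = ≗⇒≲ λ _ → refl

+-half : ∀ p ε → p + ε * ½ + ε * ½ ≡ p + ε
+-half p ε = trans (ℚ.+-assoc p (ε * ½) (ε * ½)) (cong (p +_) (half+half ε))

≲-trans : ∀ {x y z} → x ≲ y → y ≲ z → x ≲ z
≲-trans {x} {y} {z} (wrap x≤y) (wrap y≤z) = wrap λ ε 0<ε →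
  Eventually-zip (λ n p q → begin
      at x n                        ≤⟨ p ⟩
      at y n + ε * ½                ≤⟨ ℚ.+-monoˡ-≤ (ε * ½) q ⟩
      at z n + ε * ½ + ε * ½        ≡⟨ +-half (at z n) ε ⟩
      at z n + ε                    ∎)
    (x≤y (ε * ½) (half-pos 0<ε)) (y≤z (ε * ½) (half-pos 0<ε))
  where open ℚ.≤-Reasoning

module ≲-Reasoning where
  infixr 2 step-≲ step-≗
  infix  3 _∎

  step-≲ : ∀ x {y z} → y ≲ z → x ≲ y → x ≲ z
  step-≲ x y≲z x≲y = ≲-trans x≲y y≲z

  step-≗ : ∀ x {y z} → y ≲ z → (∀ n → at x n ≡ at y n) → x ≲ z
  step-≗ x y≲z x≗y = ≲-trans (≗⇒≲ x≗y) y≲z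

  _∎ : ∀ x → x ≲ x
  x ∎ = ≲-refl {x}

  syntax step-≲ x y≲z x≲y = x ≲⟨ x≲y ⟩ y≲z
  syntax step-≗ x y≲z x≗y = x ≗⟨ x≗y ⟩ y≲z

+-mono-≲ : ∀ {x y z w} → x ≲ y → z ≲ w → x +ᴿ z ≲ y +ᴿ w
+-mono-≲ {x} {y} {z} {w} (wrap x≤y) (wrap z≤w) = wrap λ ε 0<ε →
  Eventually-zip (λ n p q → begin
      at x n + at z n                        ≤⟨ ℚ.+-mono-≤ p q ⟩
      (at y n + ε * ½) + (at w n + ε * ½)
        ≡⟨ solve 3 (λ a b e → (a :+ e) :+ (b :+ e) := (a :+ b) :+ e :+ e) refl (at y n) (at w n) (ε * ½) ⟩
      (at y n + at w n) + ε * ½ + ε * ½      ≡⟨ +-half (at y n + at w n) ε ⟩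
      (at y n + at w n) + ε                  ∎)
    (x≤y (ε * ½) (half-pos 0<ε)) (z≤w (ε * ½) (half-pos 0<ε))
  where open ℚ.≤-Reasoning

≲-approx : ∀ {x y} → (∀ ε → 0ℚ ℚ.< ε → x ≲ y +ᴿ ratᴿ ε) → x ≲ y
≲-approx {x} {y} h = wrap λ ε 0<ε →
  Eventually-map {λ n → at x n ℚ.≤ at y n + ε * ½ + ε * ½}
    (λ n p → subst (at x n ℚ.≤_) (+-half (at y n) ε) p)
    (unwrap (h (ε * ½) (half-pos 0<ε)) (ε * ½) (half-pos 0<ε))

Eventually-≲ : ∀ {x y} → Eventually (λ n → at x n ℚ.≤ at y n) → x ≲ y
Eventually-≲ {x} {y} h = wrap λ ε 0<ε →
  Eventually-map {λ n → at x n ℚ.≤ at y n} (λ n p → ℚ.≤-trans p (p≤p+ε {at y n} 0<ε)) h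

∣∣-bounded : ∀ x → ∃ λ K → 0ℚ ℚ.< K × ∣ x ∣ᴿ ≲ ratᴿ K
∣∣-bounded x = let K , 0<K , x≤K = bounded (real x) in K , 0<K , Eventually-≲ {∣ x ∣ᴿ} {ratᴿ K} x≤K

∣∣-intro : ∀ {x a} → x ≲ a → -ᴿ x ≲ a → ∣ x ∣ᴿ ≲ a
∣∣-intro {x} {a} (wrap x≤a) (wrap -x≤a) = wrap λ ε 0<ε →
  Eventually-zip (λ n p q → abs (at x n) p q) (x≤a ε 0<ε) (-x≤a ε 0<ε)
  where
  abs : ∀ p {c} → p ℚ.≤ c → - p ℚ.≤ c → ∣ p ∣ ℚ.≤ c
  abs p p≤c -p≤c with ℚ.∣p∣≡p∨∣p∣≡-p p
  ... | inj₁ eq = ℚ.≤-trans (ℚ.≤-reflexive eq) p≤c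
  ... | inj₂ eq = ℚ.≤-trans (ℚ.≤-reflexive eq) -p≤c

≲∣∣ : ∀ x → x ≲ ∣ x ∣ᴿ
≲∣∣ x = pointwise-≲ λ n → p≤∣p∣ (at x n)

0≲∣∣ : ∀ x → 0ᴿ ≲ ∣ x ∣ᴿ
0≲∣∣ x = pointwise-≲ λ n → ℚ.0≤∣p∣ (at x n)

∣∣-resp-≗ : ∀ {x y a} → ∣ y ∣ᴿ ≲ a → (∀ n → at x n ≡ at y n) → ∣ x ∣ᴿ ≲ a
∣∣-resp-≗ y≤a x≗y = ≲-trans (≗⇒≲ λ n → cong ∣_∣ (x≗y n)) y≤a

≲-respʳ-≗ : ∀ {x y z} → x ≲ y → (∀ n → at y n ≡ at z n) → x ≲ z
≲-respʳ-≗ x≤y y≗z = ≲-trans x≤y (≗⇒≲ y≗z)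

∣∣-+ : ∀ {x y a b} → ∣ x ∣ᴿ ≲ a → ∣ y ∣ᴿ ≲ b → ∣ x +ᴿ y ∣ᴿ ≲ a +ᴿ b
∣∣-+ {x} {y} {a} {b} x≤a y≤b =
  ∣ x +ᴿ y ∣ᴿ          ≲⟨ (pointwise-≲ λ n → ℚ.∣p+q∣≤∣p∣+∣q∣ (at x n) (at y n)) ⟩
  ∣ x ∣ᴿ +ᴿ ∣ y ∣ᴿ     ≲⟨ +-mono-≲ x≤a y≤b ⟩
  a +ᴿ b               ∎
  where open ≲-Reasoning

≲⇒0≲- : ∀ {x y} → x ≲ y → 0ᴿ ≲ y -ᴿ x
≲⇒0≲- {x} {y} x≤y =
  0ᴿ         ≗⟨ (λ n → sym (ℚ.+-inverseʳ (at x n))) ⟩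
  x -ᴿ x     ≲⟨ +-mono-≲ x≤y ≲-refl ⟩
  y -ᴿ x     ∎
  where open ≲-Reasoning

0≲-⇒≲ : ∀ {x y} → 0ᴿ ≲ y -ᴿ x → x ≲ y
0≲-⇒≲ {x} {y} 0≤y-x =
  x                ≗⟨ (λ n → sym (ℚ.+-identityˡ (at x n))) ⟩
  0ᴿ +ᴿ x          ≲⟨ +-mono-≲ 0≤y-x ≲-refl ⟩
  (y -ᴿ x) +ᴿ x    ≗⟨ (λ n → solve 2 (λ x y → y :- x :+ x := y) refl (at x n) (at y n)) ⟩
  y                ∎
  where open ≲-Reasoning

neg-mono-≲ : ∀ {x y} → x ≲ y → -ᴿ y ≲ -ᴿ x
neg-mono-≲ {x} {y} x≤y = 0≲-⇒≲ (
  0ᴿ                  ≲⟨ ≲⇒0≲- x≤y ⟩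
  y -ᴿ x              ≗⟨ (λ n → solve 2 (λ x y → y :- x := :- x :- (:- y)) refl (at x n) (at y n)) ⟩
  (-ᴿ x) -ᴿ (-ᴿ y)    ∎)
  where open ≲-Reasoning

∣∣-nonNeg : ∀ {x} → 0ᴿ ≲ x → ∣ x ∣ᴿ ≲ x
∣∣-nonNeg {x} 0≤x = ∣∣-intro ≲-refl (
  -ᴿ x      ≲⟨ neg-mono-≲ 0≤x ⟩
  -ᴿ 0ᴿ     ≗⟨ (λ _ → refl) ⟩
  0ᴿ        ≲⟨ 0≤x ⟩
  x         ∎)
  where open ≲-Reasoning

∣∣-* : ∀ {x y a b} → ∣ x ∣ᴿ ≲ a → ∣ y ∣ᴿ ≲ b → ∣ x *ᴿ y ∣ᴿ ≲ a *ᴿ b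
∣∣-* {x} {y} {a} {b} (wrap x≤a) (wrap y≤b) = wrap λ ε 0<ε → bound ε 0<ε
  where
  open ℚ.≤-Reasoning
  -- Expanding (a+η)(b+η) leaves the error aη + η(b+η). The condition η ≤ 1 bounds b + η by L + 1,
  -- so the error budget is split between K and L + 1.
  below-1 : ∀ δ → 0ℚ ℚ.< δ → ∃ λ η → 0ℚ ℚ.< η × η ℚ.≤ δ × η ℚ.≤ 1ℚ
  below-1 δ 0<δ with ℚ.≤-total δ 1ℚ
  ... | inj₁ δ≤1 = δ , 0<δ , ℚ.≤-refl , δ≤1
  ... | inj₂ 1≤δ = 1ℚ , ℚ.positive⁻¹ 1ℚ , 1≤δ , ℚ.≤-refl

  bound : ∀ ε → 0ℚ ℚ.< ε → Eventually λ n → ∣ at x n * at y n ∣ ℚ.≤ at a n * at b n + ε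
  bound ε 0<ε =
    let K , 0<K , a≤K       = bounded (real a)
        L , 0<L , b≤L       = bounded (real b)
        δ , 0<δ , Kδ+δL≡ε   = split-error 0<K (ℚ.+-mono-< 0<L (ℚ.positive⁻¹ 1ℚ)) 0<ε
        η , 0<η , η≤δ , η≤1 = below-1 δ 0<δ
    in Eventually-zip (λ n (p , q) (u , v) → begin
        ∣ at x n * at y n ∣
          ≡⟨ ℚ.∣p*q∣≡∣p∣*∣q∣ (at x n) (at y n) ⟩
        ∣ at x n ∣ * ∣ at y n ∣
          ≤⟨ ℚ-*-mono-≤ (ℚ.0≤∣p∣ (at y n)) (ℚ.≤-trans (ℚ.0≤∣p∣ (at x n)) p) p q ⟩
        (at a n + η) * (at b n + η)
          ≡⟨ solve 3 (λ a b e → (a :+ e) :* (b :+ e) := a :* b :+ (a :* e :+ e :* (b :+ e))) refl (at a n) (at b n) η ⟩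
        at a n * at b n + (at a n * η + η * (at b n + η))
          ≤⟨ ℚ.+-monoʳ-≤ (at a n * at b n) (ℚ.+-mono-≤
               (*-monoʳ η (ℚ.<⇒≤ 0<η) (ℚ.≤-trans (p≤∣p∣ (at a n)) u))
               (*-monoˡ η (ℚ.<⇒≤ 0<η) (ℚ.+-mono-≤ (ℚ.≤-trans (p≤∣p∣ (at b n)) v) η≤1))) ⟩
        at a n * at b n + (K * η + η * (L + 1ℚ))
          ≤⟨ ℚ.+-monoʳ-≤ (at a n * at b n) (ℚ.+-mono-≤
               (*-monoˡ K (ℚ.<⇒≤ 0<K) η≤δ)
               (*-monoʳ (L + 1ℚ) (ℚ.<⇒≤ (ℚ.+-mono-< 0<L (ℚ.positive⁻¹ 1ℚ))) η≤δ)) ⟩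
        at a n * at b n + (K * δ + δ * (L + 1ℚ))
          ≡⟨ cong (at a n * at b n +_) Kδ+δL≡ε ⟩
        at a n * at b n + ε ∎)
      (Eventually-zip (λ n p q → p , q) (x≤a η 0<η) (y≤b η 0<η))
      (Eventually-zip (λ n p q → p , q) a≤K b≤L)

*-mono-≲ : ∀ {x y z w} → 0ᴿ ≲ x → 0ᴿ ≲ z → x ≲ y → z ≲ w → x *ᴿ z ≲ y *ᴿ w
*-mono-≲ {x} {y} {z} {w} 0≤x 0≤z x≤y z≤w = ≲-trans (≲∣∣ (x *ᴿ z))
  (∣∣-* (≲-trans (∣∣-nonNeg 0≤x) x≤y) (≲-trans (∣∣-nonNeg 0≤z) z≤w))

ratᴿ-mono-≲ : ∀ {p q} → p ℚ.≤ q → ratᴿ p ≲ ratᴿ q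
ratᴿ-mono-≲ p≤q = pointwise-≲ λ _ → p≤q

0≲+ : ∀ {x y} → 0ᴿ ≲ x → 0ᴿ ≲ y → 0ᴿ ≲ x +ᴿ y
0≲+ {x} {y} 0≤x 0≤y =
  0ᴿ           ≗⟨ (λ _ → refl) ⟩
  0ᴿ +ᴿ 0ᴿ     ≲⟨ +-mono-≲ 0≤x 0≤y ⟩
  x +ᴿ y       ∎
  where open ≲-Reasoning

0≲* : ∀ {x y} → 0ᴿ ≲ x → 0ᴿ ≲ y → 0ᴿ ≲ x *ᴿ y
0≲* {x} {y} 0≤x 0≤y =
  0ᴿ           ≗⟨ (λ _ → refl) ⟩
  0ᴿ *ᴿ 0ᴿ     ≲⟨ *-mono-≲ ≲-refl ≲-refl 0≤x 0≤y ⟩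
  x *ᴿ y       ∎
  where open ≲-Reasoning

∣-∣-sym : ∀ x y → ∣ x -ᴿ y ∣ᴿ ≲ ∣ y -ᴿ x ∣ᴿ
∣-∣-sym x y = ≗⇒≲ λ n → ∣p-q∣≡∣q-p∣ (at x n) (at y n)

∣∣-zero : ∀ {x} → (∀ n → at x n ≡ 0ℚ) → ∣ x ∣ᴿ ≲ 0ᴿ
∣∣-zero x≗0 = ≗⇒≲ λ n → cong ∣_∣ (x≗0 n)

-- All complex errors below have vanishing imaginary part, so the real part may use up the whole of
-- ε.
Modulus-intro : ∀ {ε z} → ∣ mkReal (re z) ∣ᴿ ≲ ratᴿ ε → ∣ mkReal (im z) ∣ᴿ ≲ 0ᴿ → Modulus≤ ε z
Modulus-intro {ε} {z} re≤ im≤ = unwrap (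
  x *ᴿ x +ᴿ y *ᴿ y                  ≲⟨ +-mono-≲ (≲-trans (≲∣∣ (x *ᴿ x)) (∣∣-* re≤ re≤))
                                                (≲-trans (≲∣∣ (y *ᴿ y)) (∣∣-* im≤ im≤)) ⟩
  ratᴿ ε *ᴿ ratᴿ ε +ᴿ 0ᴿ *ᴿ 0ᴿ      ≗⟨ (λ _ → ℚ.+-identityʳ (ε * ε)) ⟩
  ratᴿ (ε * ε)                      ∎)
  where
  open ≲-Reasoning
  x = mkReal (re z)
  y = mkReal (im z)

-- Differentiation with quadratic remainder

_∈[0,_] : Real → Real → Set
s ∈[0, T ] = 0ᴿ ≲ s × s ≲ T

remainder : (Real → Real) → (Real → Real) → Real → Real → Real
remainder f f′ s t = f t -ᴿ f s -ᴿ f′ s *ᴿ (t -ᴿ s)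

-- The remainder is quadratic, so Riemann sums of f′ telescope up to the mesh width.
record DifferentiableOn (T : Real) (f f′ : Real → Real) : Set where
  field
    constant   : ℚ
    0≤constant : 0ℚ ℚ.≤ constant
    bound      : ∀ s → s ∈[0, T ] → ∣ f s ∣ᴿ ≲ ratᴿ constant
    lipschitz  : ∀ s t → s ∈[0, T ] → t ∈[0, T ] →
                 ∣ f t -ᴿ f s ∣ᴿ ≲ ratᴿ constant *ᴿ ∣ t -ᴿ s ∣ᴿ
    remainder≲ : ∀ s t → s ∈[0, T ] → t ∈[0, T ] →
                 ∣ remainder f f′ s t ∣ᴿ ≲ ratᴿ constant *ᴿ (∣ t -ᴿ s ∣ᴿ *ᴿ ∣ t -ᴿ s ∣ᴿ)

Differentiable : (Real → Real) → (Real → Real) → Set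
Differentiable f f′ = ∀ T → DifferentiableOn T f f′

Differentiable-0 : Differentiable (λ _ → 0ᴿ) (λ _ → 0ᴿ)
Differentiable-0 T = record
  { constant   = 0ℚ
  ; 0≤constant = ℚ.≤-refl
  ; bound      = λ _ _ → ∣∣-zero λ _ → refl
  ; lipschitz  = λ s t _ _ → ≲-respʳ-≗ (∣∣-zero λ _ → refl)
      (λ n → sym (ℚ.*-zeroˡ ∣ at t n - at s n ∣))
  ; remainder≲ = λ s t _ _ → ≲-respʳ-≗
      (∣∣-zero λ n → solve 1 (λ d → con 0ℚ :- con 0ℚ :- con 0ℚ :* d := con 0ℚ) refl (at t n - at s n))
      (λ n → sym (ℚ.*-zeroˡ (∣ at t n - at s n ∣ * ∣ at t n - at s n ∣)))
  }

Differentiable-+ : ∀ {f f′ g g′} → Differentiable f f′ → Differentiable g g′ →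
                   Differentiable (λ t → f t +ᴿ g t) (λ t → f′ t +ᴿ g′ t)
Differentiable-+ {f} {f′} {g} {g′} df dg T = record
  { constant   = F.constant + G.constant
  ; 0≤constant = 0≤+ F.0≤constant G.0≤constant
  ; bound      = λ s s∈ → ≲-respʳ-≗ (∣∣-+ (F.bound s s∈) (G.bound s s∈)) λ _ → refl
  ; lipschitz  = λ s t s∈ t∈ → ≲-respʳ-≗
      (∣∣-resp-≗ (∣∣-+ (F.lipschitz s t s∈ t∈) (G.lipschitz s t s∈ t∈))
        (λ n → solve 4 (λ a b c d → (a :+ b) :- (c :+ d) := (a :- c) :+ (b :- d)) refl
          (at (f t) n) (at (g t) n) (at (f s) n) (at (g s) n)))
      (λ n → sym (ℚ.*-distribʳ-+ ∣ at t n - at s n ∣ F.constant G.constant))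
  ; remainder≲ = λ s t s∈ t∈ → ≲-respʳ-≗
      (∣∣-resp-≗ (∣∣-+ (F.remainder≲ s t s∈ t∈) (G.remainder≲ s t s∈ t∈))
        (λ n → solve 7 (λ a b c d e h w →
            (a :+ b) :- (c :+ d) :- (e :+ h) :* w := (a :- c :- e :* w) :+ (b :- d :- h :* w)) refl
          (at (f t) n) (at (g t) n) (at (f s) n) (at (g s) n) (at (f′ s) n) (at (g′ s) n) (at t n - at s n)))
      (λ n → sym (ℚ.*-distribʳ-+ (∣ at t n - at s n ∣ * ∣ at t n - at s n ∣) F.constant G.constant))
  }
  where
  module F = DifferentiableOn (df T)
  module G = DifferentiableOn (dg T)

∣ratᴿ∣ : ∀ q → ∣ ratᴿ q ∣ᴿ ≲ ratᴿ ∣ q ∣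
∣ratᴿ∣ q = ≗⇒≲ λ _ → refl

Differentiable-scale : ∀ q {f f′} → Differentiable f f′ →
                       Differentiable (λ t → ratᴿ q *ᴿ f t) (λ t → ratᴿ q *ᴿ f′ t)
Differentiable-scale q {f} {f′} df T = record
  { constant   = ∣ q ∣ * F.constant
  ; 0≤constant = 0≤* (ℚ.0≤∣p∣ q) F.0≤constant
  ; bound      = λ s s∈ → ≲-respʳ-≗ (∣∣-* (∣ratᴿ∣ q) (F.bound s s∈)) λ _ → refl
  ; lipschitz  = λ s t s∈ t∈ → ≲-respʳ-≗
      (∣∣-resp-≗ (∣∣-* (∣ratᴿ∣ q) (F.lipschitz s t s∈ t∈))
        (λ n → solve 3 (λ q a b → q :* a :- q :* b := q :* (a :- b)) refl q (at (f t) n) (at (f s) n)))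
      (λ n → sym (ℚ.*-assoc (∣ q ∣) F.constant ∣ at t n - at s n ∣))
  ; remainder≲ = λ s t s∈ t∈ → ≲-respʳ-≗
      (∣∣-resp-≗ (∣∣-* (∣ratᴿ∣ q) (F.remainder≲ s t s∈ t∈))
        (λ n → solve 5 (λ q a b c w → q :* a :- q :* b :- q :* c :* w := q :* (a :- b :- c :* w)) refl
          q (at (f t) n) (at (f s) n) (at (f′ s) n) (at t n - at s n)))
      (λ n → sym (ℚ.*-assoc (∣ q ∣) F.constant (∣ at t n - at s n ∣ * ∣ at t n - at s n ∣)))
  }
  where module F = DifferentiableOn (df T)

-- The remainder of a product is rem(f)·g + f·rem(g) + Δf·Δg. The three pieces use the quadratic,
-- uniform and Lipschitz bounds of the factors, and each costs K, the product of their constants;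
-- hence 3K.
Differentiable-* : ∀ {f f′ g g′} → Differentiable f f′ → Differentiable g g′ →
                   Differentiable (λ t → f t *ᴿ g t) (λ t → f′ t *ᴿ g t +ᴿ f t *ᴿ g′ t)
Differentiable-* {f} {f′} {g} {g′} df dg T = record
  { constant   = K + K + K
  ; 0≤constant = 0≤+ (0≤+ 0≤K 0≤K) 0≤K
  ; bound      = λ s s∈ → ≲-trans (∣∣-* (F.bound s s∈) (G.bound s s∈)) (pointwise-≲ λ _ → K≤3K)
  ; lipschitz  = λ s t s∈ t∈ → ≲-trans
      (∣∣-resp-≗ (∣∣-+ (∣∣-* (F.lipschitz s t s∈ t∈) (G.bound t t∈)) (∣∣-* (F.bound s s∈) (G.lipschitz s t s∈ t∈)))
        (λ n → solve 4 (λ a b c d → a :* b :- c :* d := (a :- c) :* b :+ c :* (b :- d)) refl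
          (at (f t) n) (at (g t) n) (at (f s) n) (at (g s) n)))
      (pointwise-≲ λ n → ℚ.≤-trans
        (ℚ.≤-reflexive (solve 3 (λ b c w → b :* w :* c :+ b :* (c :* w) := (b :* c :+ b :* c) :* w) refl
          F.constant G.constant ∣ at t n - at s n ∣))
        (*-monoʳ ∣ at t n - at s n ∣ (ℚ.0≤∣p∣ (at t n - at s n)) 2K≤3K))
  ; remainder≲ = λ s t s∈ t∈ → ≲-respʳ-≗
      (∣∣-resp-≗ (∣∣-+ (∣∣-+
          (∣∣-* (F.remainder≲ s t s∈ t∈) (G.bound s s∈))
          (∣∣-* (F.bound s s∈) (G.remainder≲ s t s∈ t∈)))
          (∣∣-* (F.lipschitz s t s∈ t∈) (G.lipschitz s t s∈ t∈)))
        (λ n → solve 7 (λ a b c d e h w →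
            a :* b :- c :* d :- (e :* d :+ c :* h) :* w
              := (a :- c :- e :* w) :* d :+ c :* (b :- d :- h :* w) :+ (a :- c) :* (b :- d)) refl
          (at (f t) n) (at (g t) n) (at (f s) n) (at (g s) n) (at (f′ s) n) (at (g′ s) n) (at t n - at s n)))
      (λ n → solve 3 (λ b c w →
          b :* (w :* w) :* c :+ b :* (c :* (w :* w)) :+ b :* w :* (c :* w)
            := (b :* c :+ b :* c :+ b :* c) :* (w :* w)) refl
        F.constant G.constant ∣ at t n - at s n ∣)
  }
  where
  module F = DifferentiableOn (df T)
  module G = DifferentiableOn (dg T)
  K = F.constant * G.constant
  0≤K = 0≤* F.0≤constant G.0≤constant
  2K≤3K : K + K ℚ.≤ K + K + K
  2K≤3K = subst (ℚ._≤ K + K + K) (ℚ.+-identityʳ (K + K)) (ℚ.+-monoʳ-≤ (K + K) 0≤K)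
  K≤3K : K ℚ.≤ K + K + K
  K≤3K = ℚ.≤-trans (subst (ℚ._≤ K + K) (ℚ.+-identityʳ K) (ℚ.+-monoʳ-≤ K 0≤K)) 2K≤3K

-- Replacing the derivative adds (f′ - g′)(t - s) to the remainder, which is null. This form admits
-- Σ x_j² = 1, known only up to equality of reals and only for nonnegative times.
Differentiable-cong : ∀ {f f′ g′} → (∀ s → 0ᴿ ≲ s → ∣ f′ s -ᴿ g′ s ∣ᴿ ≲ 0ᴿ) →
                      Differentiable f f′ → Differentiable f g′
Differentiable-cong {f} {f′} {g′} f′≈g′ df T = record
  { constant   = F.constant
  ; 0≤constant = F.0≤constant
  ; bound      = F.bound
  ; lipschitz  = F.lipschitz
  ; remainder≲ = λ s t s∈ t∈ → ≲-respʳ-≗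
      (∣∣-resp-≗ (∣∣-+ (F.remainder≲ s t s∈ t∈) (∣∣-* (f′≈g′ s (proj₁ s∈)) (≲-refl {∣ t -ᴿ s ∣ᴿ})))
        (λ n → solve 5 (λ a b c d w → a :- b :- d :* w := (a :- b :- c :* w) :+ (c :- d) :* w) refl
          (at (f t) n) (at (f s) n) (at (f′ s) n) (at (g′ s) n) (at t n - at s n)))
      (λ n → trans (cong (F.constant * (∣ at t n - at s n ∣ * ∣ at t n - at s n ∣) +_)
               (ℚ.*-zeroˡ ∣ at t n - at s n ∣))
             (ℚ.+-identityʳ (F.constant * (∣ at t n - at s n ∣ * ∣ at t n - at s n ∣))))
  }
  where module F = DifferentiableOn (df T)

Differentiable-≗ : ∀ {f f′ g′} → (∀ s n → at (f′ s) n ≡ at (g′ s) n) →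
                   Differentiable f f′ → Differentiable f g′
Differentiable-≗ {g′ = g′} f′≗g′ = Differentiable-cong λ s _ → ∣∣-zero λ n →
  trans (cong (_- at (g′ s) n) (f′≗g′ s n)) (ℚ.+-inverseʳ (at (g′ s) n))

sumᴿ : ∀ {n} → (Fin n → Real) → Real
sumᴿ {zero}  x = 0ᴿ
sumᴿ {suc n} x = x zero +ᴿ sumᴿ (x ∘ suc)

at-sumᴿ : ∀ {n} (x : Fin n → Real) p → at (sumᴿ x) p ≡ sum λ j → at (x j) p
at-sumᴿ {zero}  x p = refl
at-sumᴿ {suc n} x p = cong (at (x zero) p +_) (at-sumᴿ (x ∘ suc) p)

Differentiable-sum : ∀ {n} {f f′ : Fin n → Real → Real} → (∀ j → Differentiable (f j) (f′ j)) →
                     Differentiable (λ t → sumᴿ λ j → f j t) (λ t → sumᴿ λ j → f′ j t)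
Differentiable-sum {zero}  df = Differentiable-0
Differentiable-sum {suc n} df = Differentiable-+ (df zero) (Differentiable-sum (df ∘ suc))

half : Real → Real
half x = ratᴿ ½ *ᴿ x

0≲½ : 0ᴿ ≲ ratᴿ ½
0≲½ = ratᴿ-mono-≲ 0≤½

half-+-half : ∀ x n → ½ * at x n + ½ * at x n ≡ at x n
half-+-half x n = solve 1 (λ x → con ½ :* x :+ con ½ :* x := x) refl (at x n)

midpoint-∈ : ∀ {T s t} → s ∈[0, T ] → t ∈[0, T ] → (half s +ᴿ half t) ∈[0, T ]
midpoint-∈ {T} {s} {t} (0≤s , s≤T) (0≤t , t≤T) =
  0≲+ (0≲* 0≲½ 0≤s) (0≲* 0≲½ 0≤t) ,
  ≲-respʳ-≗ (+-mono-≲ (*-mono-≲ 0≲½ 0≤s ≲-refl s≤T) (*-mono-≲ 0≲½ 0≤t ≲-refl t≤T)) (half-+-half T)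

-- Bisection halves the quadratic bound at every step.
zero-derivative⇒constant : ∀ {f} → Differentiable f (λ _ → 0ᴿ) → ∀ t → 0ᴿ ≲ t → ∣ f t -ᴿ f 0ᴿ ∣ᴿ ≲ 0ᴿ
zero-derivative⇒constant {f} df T 0≤T = ≲-approx small
  where
  open DifferentiableOn (df T)

  bisect : ∀ k s t → s ∈[0, T ] → t ∈[0, T ] →
           ∣ f t -ᴿ f s ∣ᴿ ≲ ratᴿ (constant * ½ ^ k) *ᴿ (∣ t -ᴿ s ∣ᴿ *ᴿ ∣ t -ᴿ s ∣ᴿ)
  bisect zero s t s∈ t∈ = ≲-respʳ-≗
    (∣∣-resp-≗ (remainder≲ s t s∈ t∈)
      (λ n → solve 3 (λ a b w → a :- b := a :- b :- con 0ℚ :* w) refl (at (f t) n) (at (f s) n) (at t n - at s n)))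
    (λ n → cong (_* (∣ at t n - at s n ∣ * ∣ at t n - at s n ∣)) (sym (ℚ.*-identityʳ constant)))
  bisect (suc k) s t s∈ t∈ = ≲-respʳ-≗
    (∣∣-resp-≗ (∣∣-+ (bisect k m t m∈ t∈) (bisect k s m s∈ m∈))
      (λ n → solve 3 (λ a b c → a :- c := (a :- b) :+ (b :- c)) refl (at (f t) n) (at (f m) n) (at (f s) n)))
    (λ n → trans (cong₂ (λ u v → Cₖ * (u * u) + Cₖ * (v * v))
        (∣half∣ (at t n - at m n) (at t n - at s n)
          (solve 2 (λ s t → t :- (con ½ :* s :+ con ½ :* t) := con ½ :* (t :- s)) refl (at s n) (at t n)))
        (∣half∣ (at m n - at s n) (at t n - at s n)
          (solve 2 (λ s t → (con ½ :* s :+ con ½ :* t) :- s := con ½ :* (t :- s)) refl (at s n) (at t n))))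
      (solve 3 (λ c h w → let w/2 = con ½ :* w in
          c :* h :* (w/2 :* w/2) :+ c :* h :* (w/2 :* w/2) := c :* (con ½ :* h) :* (w :* w)) refl
        constant (½ ^ k) ∣ at t n - at s n ∣))
    where
    m = half s +ᴿ half t
    m∈ = midpoint-∈ s∈ t∈
    Cₖ = constant * ½ ^ k
    ∣half∣ : ∀ p q → p ≡ ½ * q → ∣ p ∣ ≡ ½ * ∣ q ∣
    ∣half∣ p q p≡½q = trans (cong ∣_∣ p≡½q) (ℚ.∣p*q∣≡∣p∣*∣q∣ ½ q)

  small : ∀ ε → 0ℚ ℚ.< ε → ∣ f T -ᴿ f 0ᴿ ∣ᴿ ≲ 0ᴿ +ᴿ ratᴿ ε
  small ε 0<ε =
    let K , 0<K , T≤K = ∣∣-bounded (T -ᴿ 0ᴿ)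
        N , C½^N≤ε = *½^→0 (constant * (K * K)) ε 0<ε
        0≤∣T-0∣ = 0≲∣∣ (T -ᴿ 0ᴿ)
    in ≲-trans (bisect N 0ᴿ T (≲-refl , 0≤T) (0≤T , ≲-refl))
      (≲-trans (*-mono-≲ (ratᴿ-mono-≲ (0≤* 0≤constant (0≤^ 0≤½ N))) (0≲* 0≤∣T-0∣ 0≤∣T-0∣)
                 ≲-refl (*-mono-≲ 0≤∣T-0∣ 0≤∣T-0∣ T≤K T≤K))
        (pointwise-≲ λ n → ℚ.≤-trans
          (ℚ.≤-reflexive
            (solve 3 (λ c h k → c :* h :* (k :* k) := c :* (k :* k) :* h) refl constant (½ ^ N) K))
          (ℚ.≤-trans (C½^N≤ε N ℕ.≤-refl) (ℚ.≤-reflexive (sym (ℚ.+-identityˡ ε))))))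

-- Riemann sums

∣∣-neg : ∀ {x a} → ∣ x ∣ᴿ ≲ a → ∣ -ᴿ x ∣ᴿ ≲ a
∣∣-neg {x} = ≲-trans (≗⇒≲ λ n → ℚ.∣-p∣≡∣p∣ (at x n))

-ᴿ-mono-≲ : ∀ {x y z w} → x ≲ y → w ≲ z → x -ᴿ z ≲ y -ᴿ w
-ᴿ-mono-≲ x≤y w≤z = +-mono-≲ x≤y (neg-mono-≲ w≤z)

∣-∣-≲ : ∀ {x y w} → x ≲ y → y -ᴿ x ≲ w → ∣ y -ᴿ x ∣ᴿ ≲ w
∣-∣-≲ x≤y y-x≤w = ≲-trans (∣∣-nonNeg (≲⇒0≲- x≤y)) y-x≤w

module RiemannSum {T : Real} {F f : Real → Real} (d : DifferentiableOn T F f) where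

  open DifferentiableOn d

  -- Expanding F around the tag τ towards both ends, the error is the remainder at x minus the
  -- remainder at y. Both distances from τ are at most y - x; in each square one factor is bounded
  -- by δ and the other by the width, so that the errors can be summed.
  interval-estimate : ∀ {δ x τ y} → x ∈[0, T ] → y ∈[0, T ] → x ≲ τ → τ ≲ y → y -ᴿ x ≲ ratᴿ δ →
    ∣ f τ *ᴿ (y -ᴿ x) -ᴿ (F y -ᴿ F x) ∣ᴿ ≲ ratᴿ ((constant + constant) * δ) *ᴿ (y -ᴿ x)
  interval-estimate {δ} {x} {τ} {y} x∈@(0≤x , x≤T) y∈@(0≤y , y≤T) x≤τ τ≤y y-x≤δ = ≲-respʳ-≗
    (∣∣-resp-≗
      (∣∣-+ (≲-trans (remainder≲ τ x τ∈ x∈) (square≲ (≲-trans (∣-∣-sym x τ) (∣-∣-≲ x≤τ (-ᴿ-mono-≲ τ≤y ≲-refl)))))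
            (∣∣-neg (≲-trans (remainder≲ τ y τ∈ y∈) (square≲ (∣-∣-≲ τ≤y (-ᴿ-mono-≲ ≲-refl x≤τ))))))
      (λ n → solve 7 (λ a b c d x s y →
          d :* (y :- x) :- (a :- b) := (b :- c :- d :* (x :- s)) :- (a :- c :- d :* (y :- s))) refl
        (at (F y) n) (at (F x) n) (at (F τ) n) (at (f τ) n) (at x n) (at τ n) (at y n)))
    (λ n → solve 3 (λ c e w → c :* (e :* w) :+ c :* (e :* w) := (c :+ c) :* e :* w) refl
      constant δ (at y n - at x n))
    where
    τ∈ : τ ∈[0, T ]
    τ∈ = ≲-trans 0≤x x≤τ , ≲-trans τ≤y y≤T
    square≲ : ∀ {z} → ∣ z ∣ᴿ ≲ y -ᴿ x →
      ratᴿ constant *ᴿ (∣ z ∣ᴿ *ᴿ ∣ z ∣ᴿ) ≲ ratᴿ constant *ᴿ (ratᴿ δ *ᴿ (y -ᴿ x))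
    square≲ {z} z≤w = *-mono-≲ (ratᴿ-mono-≲ 0≤constant) (0≲* (0≲∣∣ z) (0≲∣∣ z)) ≲-refl
      (*-mono-≲ (0≲∣∣ z) (0≲∣∣ z) (≲-trans z≤w y-x≤δ) z≤w)

  sum-estimate : ∀ {δ m} (point : Fin (suc m) → Real) (tag : Fin m → Real) →
    (∀ p → point p ∈[0, T ]) →
    (∀ p → point (inject₁ p) ≲ tag p) → (∀ p → tag p ≲ point (suc p)) →
    (∀ p → point (suc p) -ᴿ point (inject₁ p) ≲ ratᴿ δ) →
    ∣ (sumᴿ λ p → f (tag p) *ᴿ (point (suc p) -ᴿ point (inject₁ p))) -ᴿ (F (point (fromℕ m)) -ᴿ F (point zero)) ∣ᴿ
      ≲ ratᴿ ((constant + constant) * δ) *ᴿ (point (fromℕ m) -ᴿ point zero)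
  sum-estimate {δ} {zero} point tag _ _ _ _ = ≲-respʳ-≗
    (∣∣-zero λ n → solve 1 (λ a → con 0ℚ :- (a :- a) := con 0ℚ) refl (at (F (point zero)) n))
    (λ n → solve 2 (λ k a → con 0ℚ := k :* (a :- a)) refl ((constant + constant) * δ) (at (point zero) n))
  sum-estimate {δ} {suc m} point tag point∈ ≤tag tag≤ width≤ = ≲-respʳ-≗
    (∣∣-resp-≗
      (∣∣-+ (interval-estimate {δ} (point∈ zero) (point∈ (suc zero)) (≤tag zero) (tag≤ zero) (width≤ zero))
            (sum-estimate {δ} (point ∘ suc) (tag ∘ suc) (point∈ ∘ suc) (≤tag ∘ suc) (tag≤ ∘ suc) (width≤ ∘ suc)))
      (λ n → solve 5 (λ h s a b c → (h :+ s) :- (c :- a) := (h :- (b :- a)) :+ (s :- (c :- b))) refl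
        (at (f (tag zero) *ᴿ (point (suc zero) -ᴿ point zero)) n)
        (at (sumᴿ λ p → f (tag (suc p)) *ᴿ (point (suc (suc p)) -ᴿ point (suc (inject₁ p)))) n)
        (at (F (point zero)) n) (at (F (point (suc zero))) n) (at (F (point (fromℕ (suc m)))) n)))
    (λ n → solve 4 (λ k a b c → k :* (b :- a) :+ k :* (c :- b) := k :* (c :- a)) refl
      ((constant + constant) * δ) (at (point zero) n) (at (point (suc zero)) n) (at (point (fromℕ (suc m))) n))

point-zero≲ : ∀ {m} (x : Fin (suc m) → Real) → (∀ p → x (inject₁ p) ≲ x (suc p)) → ∀ p → x zero ≲ x p
point-zero≲ x mono zero = ≲-refl
point-zero≲ {suc m} x mono (suc p) = ≲-trans (mono zero) (point-zero≲ (x ∘ suc) (mono ∘ suc) p)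

≲point-last : ∀ {m} (x : Fin (suc m) → Real) → (∀ p → x (inject₁ p) ≲ x (suc p)) → ∀ p → x p ≲ x (fromℕ m)
≲point-last {zero}  x mono zero    = ≲-refl
≲point-last {suc m} x mono zero    = ≲-trans (mono zero) (≲point-last (x ∘ suc) (mono ∘ suc) zero)
≲point-last {suc m} x mono (suc p) = ≲point-last (x ∘ suc) (mono ∘ suc) p

seq-re-sumℂ : ∀ {m} {z : Fin m → ℂ} {x : Fin m → ℚ} n → (∀ p → seq (re (z p)) n ≡ x p) →
              seq (re (sumℂ z)) n ≡ sum x
seq-re-sumℂ {zero}  n z≗x = refl
seq-re-sumℂ {suc m} {z} {x} n z≗x =
  cong₂ _+_ (z≗x zero) (seq-re-sumℂ {z = z ∘ suc} {x ∘ suc} n (z≗x ∘ suc))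

seq-im-sumℂ : ∀ {m} {z : Fin m → ℂ} n → (∀ p → seq (im (z p)) n ≡ 0ℚ) → seq (im (sumℂ z)) n ≡ 0ℚ
seq-im-sumℂ {zero}  n z≗0 = refl
seq-im-sumℂ {suc m} {z} n z≗0 = cong₂ _+_ (z≗0 zero) (seq-im-sumℂ {z = z ∘ suc} n (z≗0 ∘ suc))

-- Agreement is demanded of the approximations at each index, so the complex and real Riemann sums
-- have identical approximations too.
record RealPart (h : ℝ → ℂ) (f : Real → Real) : Set where
  field
    re-≗ : ∀ t n → seq (re (h t)) n ≡ at (f (mkReal t)) n
    im-≗ : ∀ t n → seq (im (h t)) n ≡ 0ℚ

-- The Riemann sum is F(last point) - F(first point) up to 2CKδ, where C is `constant` and K bounds
-- T. The end points of a partition are 0 and T only up to `_≈ℝ_`; the Lipschitz bound carries F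
-- across these null gaps.
fundamental-theorem : ∀ {h F f} → RealPart h f → Differentiable F f → ∀ T → 0ᴿ ≲ mkReal T →
                      HasIntegral h 0ℝ T (fromℝ (real (F (mkReal T) -ᴿ F 0ᴿ)))
fundamental-theorem {h} {F} {f} h≗f dF T 0≤T ε 0<ε =
  let K , 0<K , ∣T∣≤K = ∣∣-bounded Tᴿ
      δ , 0<δ , CKδ≤ε = shrink {(constant + constant) * K}
        (0≤* (0≤+ 0≤constant 0≤constant) (ℚ.<⇒≤ 0<K)) 0<ε
  in δ , 0<δ , λ P width≤δ → estimate P K δ ∣T∣≤K 0<δ CKδ≤ε (λ p → wrap (width≤δ p))
  where
  Tᴿ = mkReal T
  open DifferentiableOn (dF Tᴿ)
  open RiemannSum (dF Tᴿ)
  open RealPart h≗f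

  estimate : (P : TaggedPartition 0ℝ T) → ∀ K δ → ∣ Tᴿ ∣ᴿ ≲ ratᴿ K → 0ℚ ℚ.< δ →
    (constant + constant) * K * δ ℚ.≤ ε →
    (∀ p → mkReal (width P p) ≲ ratᴿ δ) → Modulus≤ ε (riemannSum P h -ℂ fromℝ (real (F Tᴿ -ᴿ F 0ᴿ)))
  estimate P K δ ∣T∣≤K 0<δ CKδ≤ε width≤ = Modulus-intro {z = riemannSum P h -ℂ fromℝ (real (F Tᴿ -ᴿ F 0ᴿ))}
    (≲-trans (∣∣-resp-≗ (∣∣-+ (∣∣-+ (sum-estimate {δ} pt tg pt∈ ≤tg tg≤ (λ p → ≲-trans {y = mkReal (width P p)} (≗⇒≲ λ _ → refl) (width≤ p)))
        (lipschitz Tᴿ last (0≤T , ≲-refl) (pt∈ (fromℕ (size P)))))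
        (lipschitz (pt zero) 0ᴿ (pt∈ zero) (≲-refl , 0≤T)))
      λ n → trans (cong (_- (at (F Tᴿ) n - at (F 0ᴿ) n)) (trans (seq-re-sumℂ
            {z = λ p → h (tag P p) *ℂ fromℝ (width P p)} n
            (λ p → trans (solve 3 (λ a b w → a :* w :- b :* con 0ℚ := a :* w) refl
                (seq (re (h (tag P p))) n) (seq (im (h (tag P p))) n) (seq (width P p) n))
              (cong (_* seq (width P p) n) (re-≗ (tag P p) n))))
            (sym (at-sumᴿ (λ p → f (tg p) *ᴿ (pt (suc p) -ᴿ pt (inject₁ p))) n))))
          (solve 5 (λ s a b c d → s :- (a :- b) := (s :- (c :- d)) :+ (c :- a) :+ (b :- d)) refl
            (at Σ n) (at (F Tᴿ) n) (at (F 0ᴿ) n) (at (F last) n) (at (F (pt zero)) n)))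
      bound-≲-ε)
    (∣∣-zero λ n → cong (_- 0ℚ) (seq-im-sumℂ {z = λ p → h (tag P p) *ℂ fromℝ (width P p)} n
      (λ p → trans (cong (λ u → seq (re (h (tag P p))) n * 0ℚ + u * seq (width P p) n) (im-≗ (tag P p) n))
        (solve 2 (λ a w → a :* con 0ℚ :+ con 0ℚ :* w := con 0ℚ) refl (seq (re (h (tag P p))) n) (seq (width P p) n)))))
    where
    pt : Fin (suc (size P)) → Real
    pt p = mkReal (point P p)
    tg : Fin (size P) → Real
    tg p = mkReal (tag P p)
    last = pt (fromℕ (size P))
    Σ = sumᴿ λ p → f (tg p) *ᴿ (pt (suc p) -ᴿ pt (inject₁ p))
    ≤tg : ∀ p → pt (inject₁ p) ≲ tg p
    ≤tg p = wrap (point≤tag P p)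
    tg≤ : ∀ p → tg p ≲ pt (suc p)
    tg≤ p = wrap (tag≤point P p)
    mono : ∀ p → pt (inject₁ p) ≲ pt (suc p)
    mono p = ≲-trans (≤tg p) (tg≤ p)
    0≤zero : 0ᴿ ≲ pt zero
    0≤zero = wrap (proj₂ (point-zero P))
    zero≤0 : pt zero ≲ 0ᴿ
    zero≤0 = wrap (proj₁ (point-zero P))
    last≤T : last ≲ Tᴿ
    last≤T = wrap (proj₁ (point-last P))
    T≤last : Tᴿ ≲ last
    T≤last = wrap (proj₂ (point-last P))
    pt∈ : ∀ p → pt p ∈[0, Tᴿ ]
    pt∈ p = ≲-trans 0≤zero (point-zero≲ pt mono p) , ≲-trans (≲point-last pt mono p) last≤T
    ∣last-T∣≤0 : ∣ last -ᴿ Tᴿ ∣ᴿ ≲ 0ᴿ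
    ∣last-T∣≤0 = ≲-trans (∣-∣-sym last Tᴿ) (∣-∣-≲ last≤T
      (≲-respʳ-≗ (-ᴿ-mono-≲ T≤last ≲-refl) λ n → ℚ.+-inverseʳ (at last n)))
    ∣0-zero∣≤0 : ∣ 0ᴿ -ᴿ pt zero ∣ᴿ ≲ 0ᴿ
    ∣0-zero∣≤0 = ≲-trans (∣-∣-sym 0ᴿ (pt zero)) (∣-∣-≲ 0≤zero
      (≲-respʳ-≗ (-ᴿ-mono-≲ zero≤0 ≲-refl) λ _ → refl))
    0≤C : 0ᴿ ≲ ratᴿ constant
    0≤C = ratᴿ-mono-≲ 0≤constant
    0≤2Cδ : 0ᴿ ≲ ratᴿ ((constant + constant) * δ)
    0≤2Cδ = ratᴿ-mono-≲ (0≤* (0≤+ 0≤constant 0≤constant) (ℚ.<⇒≤ 0<δ))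
    last-zero≤K : last -ᴿ pt zero ≲ ratᴿ K
    last-zero≤K = ≲-trans (-ᴿ-mono-≲ last≤T 0≤zero)
      (≲-trans (≗⇒≲ λ n → ℚ.+-identityʳ (at Tᴿ n)) (≲-trans (≲∣∣ Tᴿ) ∣T∣≤K))
    bound-≲-ε : ratᴿ ((constant + constant) * δ) *ᴿ (last -ᴿ pt zero)
          +ᴿ ratᴿ constant *ᴿ ∣ last -ᴿ Tᴿ ∣ᴿ +ᴿ ratᴿ constant *ᴿ ∣ 0ᴿ -ᴿ pt zero ∣ᴿ ≲ ratᴿ ε
    bound-≲-ε = ≲-trans (+-mono-≲ (+-mono-≲
        (*-mono-≲ 0≤2Cδ (≲⇒0≲- (point-zero≲ pt mono (fromℕ (size P)))) ≲-refl last-zero≤K)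
        (*-mono-≲ 0≤C (0≲∣∣ _) ≲-refl ∣last-T∣≤0))
        (*-mono-≲ 0≤C (0≲∣∣ _) ≲-refl ∣0-zero∣≤0))
      (≲-trans (≗⇒≲ λ n → solve 3 (λ c d k →
          (c :+ c) :* d :* k :+ c :* con 0ℚ :+ c :* con 0ℚ := (c :+ c) :* k :* d) refl constant δ K)
        (ratᴿ-mono-≲ {(constant + constant) * K * δ} CKδ≤ε))

-- Power series

Eventually-suc : ∀ {P : ℕ → Set} → Eventually (λ n → P (suc n)) → Eventually P
Eventually-suc (N , p) = suc N , λ { (suc n) (ℕ.s≤s N≤n) → p n N≤n }

Eventually-pred : ∀ {P : ℕ → Set} → Eventually P → Eventually (λ n → P (suc n))
Eventually-pred (N , p) = N , λ n N≤n → p (suc n) (ℕ.m≤n⇒m≤1+n N≤n)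

-- A diagonal sequence: truncation and argument are refined together. Linear relations between
-- coefficients therefore become exact relations between approximations.
powerSeries : ∀ a → Entire a → Real → Real
powerSeries a entire t .real .seq p = powerSum a p (at t p)
powerSeries a entire t .real .cauchy ε 0<ε =
  let K , 0<K , N₁ , t≤K = bounded (real t)
      -- The bound on t is enlarged from K to L = K + 1, because the power sum estimates require L ≥
      -- 1.
      1≤L = ℚ.≤-trans (p≤p+ε {1ℚ} 0<K) (ℚ.≤-reflexive (ℚ.+-comm 1ℚ K))
      0≤L = ℚ.≤-trans 0≤1 1≤L
      L = K + 1ℚ
      C , a≤ = entire (L + L + (L + L)) (0≤+ (0≤+ 0≤L 0≤L) (0≤+ 0≤L 0≤L))
      ε/2 = ε * ½
      0<ε/2 = half-pos 0<ε
      0≤C = geometric⇒0≤C {C} {λ r → a r * 0ℚ ^ r} (powerTerms-geometric {a} {L} {C} 1≤L a≤ 0≤L)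
      δ , 0<δ , 2Cδ≤ε/2 = shrink {C + C} (0≤+ 0≤C 0≤C) 0<ε/2
      N₂ , tδ = cauchy (real t) δ 0<δ
      N₃ , C½≤ = *½^→0 (C + C) (ε/2 * ½) (half-pos 0<ε/2)
      N = N₁ ℕ.⊔ N₂ ℕ.⊔ N₃
      N₁₂ = N₁ ℕ.⊔ N₂
  in N , λ m n N≤m N≤n →
    let N₁₂≤m = ℕ.m⊔n≤o⇒m≤o N₁₂ N₃ N≤m
        N₁₂≤n = ℕ.m⊔n≤o⇒m≤o N₁₂ N₃ N≤n
        p≤L = λ {q} (q≤K : ∣ q ∣ ℚ.≤ K) → ℚ.≤-trans q≤K (p≤p+ε {K} (ℚ.positive⁻¹ 1ℚ))
        tₘ≤L = p≤L {at t m} (t≤K m (ℕ.m⊔n≤o⇒m≤o N₁ N₂ N₁₂≤m))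
        tₙ≤L = p≤L {at t n} (t≤K n (ℕ.m⊔n≤o⇒m≤o N₁ N₂ N₁₂≤n))
        tδ′ = tδ m n (ℕ.m⊔n≤o⇒n≤o N₁ N₂ N₁₂≤m) (ℕ.m⊔n≤o⇒n≤o N₁ N₂ N₁₂≤n)
    in estimate m n N
         (ℚ.≤-trans (powerSum-lipschitz {a} {L} {C} 1≤L a≤ {at t n} {at t m} tₙ≤L tₘ≤L m)
           (ℚ.≤-trans (*-monoˡ (C + C) (0≤+ 0≤C 0≤C) tδ′) 2Cδ≤ε/2))
         (ℚ.≤-trans (partialSum-tail {C} {λ r → a r * at t n ^ r} (powerTerms-geometric {a} {L} {C} 1≤L a≤ tₙ≤L) N≤m)
           (C½≤ N (ℕ.m≤n⊔m N₁₂ N₃)))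
         (ℚ.≤-trans (partialSum-tail {C} {λ r → a r * at t n ^ r} (powerTerms-geometric {a} {L} {C} 1≤L a≤ tₙ≤L) N≤n)
           (C½≤ N (ℕ.m≤n⊔m N₁₂ N₃)))
  where
  open PowerSumEstimates
  -- The argument is changed at the fixed truncation m, at cost ε/2; then both truncations are
  -- compared with N at the fixed argument, at cost ε/4 each.
  estimate : ∀ m n N →
    ∣ powerSum a m (at t m) - powerSum a m (at t n) ∣ ℚ.≤ ε * ½ →
    ∣ powerSum a m (at t n) - powerSum a N (at t n) ∣ ℚ.≤ ε * ½ * ½ →
    ∣ powerSum a n (at t n) - powerSum a N (at t n) ∣ ℚ.≤ ε * ½ * ½ →
    ∣ powerSum a m (at t m) - powerSum a n (at t n) ∣ ℚ.≤ ε
  estimate m n N u v w = begin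
    ∣ x - z ∣
      ≡⟨ cong ∣_∣ (solve 4 (λ x y z o → x :- z := (x :- y) :+ ((y :- o) :+ (o :- z))) refl x y z o) ⟩
    ∣ (x - y) + ((y - o) + (o - z)) ∣
      ≤⟨ ∣∣-+-mono u (∣∣-+-mono v (ℚ.≤-trans (ℚ.≤-reflexive (∣p-q∣≡∣q-p∣ o z)) w)) ⟩
    ε * ½ + (ε * ½ * ½ + ε * ½ * ½)
      ≡⟨ cong (ε * ½ +_) (half+half (ε * ½)) ⟩
    ε * ½ + ε * ½
      ≡⟨ half+half ε ⟩
    ε ∎
    where
    open ℚ.≤-Reasoning
    x = powerSum a m (at t m)
    y = powerSum a m (at t n)
    z = powerSum a n (at t n)
    o = powerSum a N (at t n)

-- An inequality of reals holds for approximations only with some slack. The slack 1 leads to K + 1,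
-- which also meets the condition L ≥ 1.
∈-bounded : ∀ {s T K} → s ∈[0, T ] → ∣ T ∣ᴿ ≲ ratᴿ K →
            Eventually λ n → ∣ at s n ∣ ℚ.≤ K + 1ℚ
∈-bounded {s} {T} {K} (0≤s , s≤T) T≤K =
  unwrap (≲-trans (∣∣-nonNeg 0≤s) (≲-trans s≤T (≲-trans (≲∣∣ T) T≤K))) 1ℚ (ℚ.positive⁻¹ 1ℚ)

-- The derivative is any function with the right approximations, so it can be supplied in the form S
-- x without building the series of derivatives separately.
Differentiable-powerSeries : ∀ a (entire : Entire a) {f′} →
  (∀ t p → at (f′ t) p ≡ powerSum (derivCoeff a) p (at t p)) →
  Differentiable (powerSeries a entire) f′
Differentiable-powerSeries a entire {f′} f′≗ T =
  let K , 0<K , T≤K = ∣∣-bounded T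
      1≤L = ℚ.≤-trans (p≤p+ε {1ℚ} 0<K) (ℚ.≤-reflexive (ℚ.+-comm 1ℚ K))
      0≤L = ℚ.≤-trans 0≤1 1≤L
      C , a≤ = entire (K + 1ℚ + (K + 1ℚ) + (K + 1ℚ + (K + 1ℚ))) (0≤+ (0≤+ 0≤L 0≤L) (0≤+ 0≤L 0≤L))
  in build K T≤K C 1≤L 0≤L a≤
  where
  f = powerSeries a entire
  build : ∀ K → ∣ T ∣ᴿ ≲ ratᴿ K → ∀ C → 1ℚ ℚ.≤ K + 1ℚ → 0ℚ ℚ.≤ K + 1ℚ →
          (∀ r → ∣ a r ∣ * (K + 1ℚ + (K + 1ℚ) + (K + 1ℚ + (K + 1ℚ))) ^ r ℚ.≤ C * ½ ^ r) →
          DifferentiableOn T f f′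
  build K T≤K C 1≤L 0≤L a≤ = record
    { constant   = C + C
    ; 0≤constant = 0≤+ 0≤C 0≤C
    ; bound      = λ s s∈ → Eventually-≲ {∣ f s ∣ᴿ} {ratᴿ (C + C)}
        (Eventually-map {λ n → ∣ at s n ∣ ℚ.≤ L}
          (λ n s≤L → partialSum-bound {C} {λ r → a r * at s n ^ r} (powerTerms-geometric s≤L) n)
          (∈-bounded s∈ T≤K))
    ; lipschitz  = λ s t s∈ t∈ → Eventually-≲ {∣ f t -ᴿ f s ∣ᴿ} {ratᴿ (C + C) *ᴿ ∣ t -ᴿ s ∣ᴿ}
        (Eventually-zip {λ n → ∣ at s n ∣ ℚ.≤ L} {λ n → ∣ at t n ∣ ℚ.≤ L}
          (λ n s≤L t≤L → powerSum-lipschitz s≤L t≤L n)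
          (∈-bounded s∈ T≤K) (∈-bounded t∈ T≤K))
    ; remainder≲ = λ s t s∈ t∈ → wrap λ ε 0<ε →
        -- `powerSum-remainder` needs at least one term, hence the shift of index. Its surplus term,
        -- with ∣t - s∣ ≤ 2L, eventually fits into the slack ε.
        Eventually-suc {λ n → at (∣ remainder f f′ s t ∣ᴿ) n ℚ.≤ at (ratᴿ (C + C) *ᴿ (∣ t -ᴿ s ∣ᴿ *ᴿ ∣ t -ᴿ s ∣ᴿ)) n + ε}
          (Eventually-zip {λ n → C * (L + L) * ½ ^ suc n ℚ.≤ ε} {λ n → ∣ at s (suc n) ∣ ℚ.≤ L × ∣ at t (suc n) ∣ ℚ.≤ L}
            (λ n C½≤ (s≤L , t≤L) → remainder-at s t ε n C½≤ s≤L t≤L)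
            (Eventually-pred {λ n → C * (L + L) * ½ ^ n ℚ.≤ ε} (*½^→0 (C * (L + L)) ε 0<ε))
            (Eventually-pred {λ n → ∣ at s n ∣ ℚ.≤ L × ∣ at t n ∣ ℚ.≤ L}
              (Eventually-zip {λ n → ∣ at s n ∣ ℚ.≤ L} {λ n → ∣ at t n ∣ ℚ.≤ L} (λ n p q → p , q)
                (∈-bounded s∈ T≤K) (∈-bounded t∈ T≤K))))
    }
    where
    L = K + 1ℚ
    open PowerSumEstimates {a} {L} {C} 1≤L a≤
    0≤C = geometric⇒0≤C {C} {λ r → a r * 0ℚ ^ r} (powerTerms-geometric 0≤L)
    remainder-at : ∀ s t ε n → C * (L + L) * ½ ^ suc n ℚ.≤ ε →
      ∣ at s (suc n) ∣ ℚ.≤ L → ∣ at t (suc n) ∣ ℚ.≤ L →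
      ∣ at (f t) (suc n) - at (f s) (suc n) - at (f′ s) (suc n) * (at t (suc n) - at s (suc n)) ∣ ℚ.≤
      (C + C) * (∣ at t (suc n) - at s (suc n) ∣ * ∣ at t (suc n) - at s (suc n) ∣) + ε
    remainder-at s t ε n C½≤ s≤L t≤L = begin
      ∣ at (f t) (suc n) - at (f s) (suc n) - at (f′ s) (suc n) * (tₙ - sₙ) ∣
        ≡⟨ cong (λ u → ∣ at (f t) (suc n) - at (f s) (suc n) - u * (tₙ - sₙ) ∣) (f′≗ s (suc n)) ⟩
      ∣ powerSum a (suc n) tₙ - powerSum a (suc n) sₙ - powerSum (derivCoeff a) (suc n) sₙ * (tₙ - sₙ) ∣
        ≤⟨ powerSum-remainder s≤L t≤L n ⟩
      (C + C) * D² + C * ½ ^ suc n * ∣ tₙ - sₙ ∣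
        ≤⟨ ℚ.+-monoʳ-≤ ((C + C) * D²) (*-monoˡ (C * ½ ^ suc n) (0≤* 0≤C (0≤^ 0≤½ (suc n)))
             (ℚ.≤-trans (ℚ.∣p-q∣≤∣p∣+∣q∣ tₙ sₙ) (ℚ.+-mono-≤ t≤L s≤L))) ⟩
      (C + C) * D² + C * ½ ^ suc n * (L + L)
        ≡⟨ cong ((C + C) * D² +_) (solve 3 (λ c h l → c :* h :* l := c :* l :* h) refl C (½ ^ suc n) (L + L)) ⟩
      (C + C) * D² + C * (L + L) * ½ ^ suc n
        ≤⟨ ℚ.+-monoʳ-≤ ((C + C) * D²) C½≤ ⟩
      (C + C) * D² + ε ∎
      where
      open ℚ.≤-Reasoning
      tₙ = at t (suc n)
      sₙ = at s (suc n)
      D² = ∣ tₙ - sₙ ∣ * ∣ tₙ - sₙ ∣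

-- Two nested thresholds, since m counts terms of the series while p indexes approximations. Both
-- truncations are compared with N, whose tail is uniform in the approximations of t.
powerSeries-converges : ∀ a (entire : Entire a) t ε → 0ℚ ℚ.< ε → Eventually λ m → Eventually λ p →
  ∣ powerSum a m (at t p) - at (powerSeries a entire t) p ∣ ℚ.≤ ε
powerSeries-converges a entire t ε 0<ε =
  let K , 0<K , N₁ , t≤K = bounded (real t)
      1≤L = ℚ.≤-trans (p≤p+ε {1ℚ} 0<K) (ℚ.≤-reflexive (ℚ.+-comm 1ℚ K))
      0≤L = ℚ.≤-trans 0≤1 1≤L
      C , a≤ = entire (K + 1ℚ + (K + 1ℚ) + (K + 1ℚ + (K + 1ℚ))) (0≤+ (0≤+ 0≤L 0≤L) (0≤+ 0≤L 0≤L))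
      N , C½≤ = *½^→0 (C + C) (ε * ½) (half-pos 0<ε)
      tail = λ p (N₁≤p : N₁ ≤ p) {q} (N≤q : N ≤ q) → ℚ.≤-trans
        (partialSum-tail {C} {λ r → a r * at t p ^ r}
          (powerTerms-geometric {a} {K + 1ℚ} {C} 1≤L a≤ (ℚ.≤-trans (t≤K p N₁≤p) (p≤p+ε {K} (ℚ.positive⁻¹ 1ℚ)))) N≤q)
        (C½≤ N ℕ.≤-refl)
  in N , λ m N≤m → N₁ ℕ.⊔ N , λ p N₁⊔N≤p →
    let N₁≤p = ℕ.m⊔n≤o⇒m≤o N₁ N N₁⊔N≤p
    in estimate m p N (tail p N₁≤p N≤m) (tail p N₁≤p (ℕ.m⊔n≤o⇒n≤o N₁ N N₁⊔N≤p))
  where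
  open PowerSumEstimates
  estimate : ∀ m p N →
    ∣ powerSum a m (at t p) - powerSum a N (at t p) ∣ ℚ.≤ ε * ½ →
    ∣ powerSum a p (at t p) - powerSum a N (at t p) ∣ ℚ.≤ ε * ½ →
    ∣ powerSum a m (at t p) - powerSum a p (at t p) ∣ ℚ.≤ ε
  estimate m p N u v = begin
    ∣ x - y ∣                  ≡⟨ cong ∣_∣ (solve 3 (λ x y o → x :- y := (x :- o) :+ (o :- y)) refl x y o) ⟩
    ∣ (x - o) + (o - y) ∣      ≤⟨ ∣∣-+-mono u (ℚ.≤-trans (ℚ.≤-reflexive (∣p-q∣≡∣q-p∣ o y)) v) ⟩
    ε * ½ + ε * ½              ≡⟨ half+half ε ⟩
    ε                          ∎
    where
    open ℚ.≤-Reasoning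
    x = powerSum a m (at t p)
    y = powerSum a p (at t p)
    o = powerSum a N (at t p)

-- Averages

-- One `height` serves all nonnegative times, whereas the `constant` of `DifferentiableOn` may grow
-- with T. Division by T therefore removes the potential in the limit.
record BoundedPrimitive (f : Real → Real) : Set where
  field
    potential      : Real → Real
    differentiable : Differentiable potential f
    height         : ℚ
    0≤height       : 0ℚ ℚ.≤ height
    potential≲     : ∀ t → 0ᴿ ≲ t → ∣ potential t ∣ᴿ ≲ ratᴿ height

open BoundedPrimitive

BoundedPrimitive-0 : BoundedPrimitive (λ _ → 0ᴿ)
BoundedPrimitive-0 = record
  { potential      = λ _ → 0ᴿ
  ; differentiable = Differentiable-0
  ; height         = 0ℚ
  ; 0≤height       = ℚ.≤-refl
  ; potential≲     = λ _ _ → ∣∣-zero λ _ → refl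
  }

BoundedPrimitive-+ : ∀ {f g} → BoundedPrimitive f → BoundedPrimitive g → BoundedPrimitive (λ t → f t +ᴿ g t)
BoundedPrimitive-+ F G = record
  { potential      = λ t → potential F t +ᴿ potential G t
  ; differentiable = Differentiable-+ (differentiable F) (differentiable G)
  ; height         = height F + height G
  ; 0≤height       = 0≤+ (0≤height F) (0≤height G)
  ; potential≲     = λ t 0≤t → ≲-respʳ-≗ (∣∣-+ (potential≲ F t 0≤t) (potential≲ G t 0≤t)) λ _ → refl
  }

BoundedPrimitive-scale : ∀ q {f} → BoundedPrimitive f → BoundedPrimitive (λ t → ratᴿ q *ᴿ f t)
BoundedPrimitive-scale q F = record
  { potential      = λ t → ratᴿ q *ᴿ potential F t
  ; differentiable = Differentiable-scale q (differentiable F)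
  ; height         = ∣ q ∣ * height F
  ; 0≤height       = 0≤* (ℚ.0≤∣p∣ q) (0≤height F)
  ; potential≲     = λ t 0≤t → ≲-respʳ-≗ (∣∣-* (∣ratᴿ∣ q) (potential≲ F t 0≤t)) λ _ → refl
  }

BoundedPrimitive-sum : ∀ {n} {f : Fin n → Real → Real} → (∀ j → BoundedPrimitive (f j)) →
                       BoundedPrimitive (λ t → sumᴿ λ j → f j t)
BoundedPrimitive-sum {zero}  F = BoundedPrimitive-0
BoundedPrimitive-sum {suc n} F = BoundedPrimitive-+ (F zero) (BoundedPrimitive-sum (F ∘ suc))

BoundedPrimitive-cong : ∀ {f g} → (∀ s → 0ᴿ ≲ s → ∣ f s -ᴿ g s ∣ᴿ ≲ 0ᴿ) → BoundedPrimitive f → BoundedPrimitive g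
BoundedPrimitive-cong f≈g F = record
  { potential      = potential F
  ; differentiable = Differentiable-cong f≈g (differentiable F)
  ; height         = height F
  ; 0≤height       = 0≤height F
  ; potential≲     = potential≲ F
  }

BoundedPrimitive-≗ : ∀ {f g} → (∀ s n → at (f s) n ≡ at (g s) n) → BoundedPrimitive f → BoundedPrimitive g
BoundedPrimitive-≗ {g = g} f≗g = BoundedPrimitive-cong λ s _ → ∣∣-zero λ n →
  trans (cong (_- at (g s) n) (f≗g s n)) (ℚ.+-inverseʳ (at (g s) n))

Differentiable-id : Differentiable (λ t → t) (λ _ → 1ᴿ)
Differentiable-id T = let K , 0<K , T≤K = ∣∣-bounded T in record
  { constant   = K + 1ℚ
  ; 0≤constant = 0≤+ (ℚ.<⇒≤ 0<K) 0≤1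
  ; bound      = λ s (0≤s , s≤T) → ≲-trans (∣∣-nonNeg 0≤s) (≲-trans s≤T (≲-trans (≲∣∣ T)
      (≲-trans T≤K (ratᴿ-mono-≲ (p≤p+ε {K} (ℚ.positive⁻¹ 1ℚ))))))
  ; lipschitz  = λ s t _ _ → ≲-trans (≗⇒≲ λ n → sym (ℚ.*-identityˡ ∣ at t n - at s n ∣))
      (*-mono-≲ (ratᴿ-mono-≲ 0≤1) (0≲∣∣ (t -ᴿ s)) (ratᴿ-mono-≲ (1≤K+1 0<K)) ≲-refl)
  ; remainder≲ = λ s t _ _ → ≲-trans
      (∣∣-zero λ n → solve 2 (λ s t → t :- s :- con 1ℚ :* (t :- s) := con 0ℚ) refl (at s n) (at t n))
      (0≲* (ratᴿ-mono-≲ (0≤+ (ℚ.<⇒≤ 0<K) 0≤1)) (0≲* (0≲∣∣ (t -ᴿ s)) (0≲∣∣ (t -ᴿ s))))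
  }
  where
  1≤K+1 : ∀ {K} → 0ℚ ℚ.< K → 1ℚ ℚ.≤ K + 1ℚ
  1≤K+1 {K} 0<K = ℚ.≤-trans (p≤p+ε {1ℚ} 0<K) (ℚ.≤-reflexive (ℚ.+-comm 1ℚ K))

module Average (c : ℚ) {f : Real → Real} (F : BoundedPrimitive (λ t → f t -ᴿ ratᴿ c)) where

  antiderivative : Real → Real
  antiderivative t = potential F t +ᴿ ratᴿ c *ᴿ t

  antiderivative-differentiable : Differentiable antiderivative f
  antiderivative-differentiable = Differentiable-≗
    (λ s n → solve 2 (λ f c → f :- c :+ c :* con 1ℚ := f) refl (at (f s) n) c)
    (Differentiable-+ (differentiable F) (Differentiable-scale c Differentiable-id))

  integral : Real → Real
  integral t = antiderivative t -ᴿ antiderivative 0ᴿ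

  integral-average : ∀ ε → 0ℚ ℚ.< ε → ∃ λ T₀ → ∀ T (0<T : 0ℝ <ℝ T) → T₀ ≤ℝ T →
    ∣ mkReal (inverse T 0<T) *ᴿ integral (mkReal T) -ᴿ ratᴿ c ∣ᴿ ≲ ratᴿ ε
  -- The threshold is twice σ: T ≥ 2σ, read with slack σ, yields approximations of T that are
  -- eventually at least σ.
  integral-average ε 0<ε = fromℚ (σ + σ) , average≲
    where
    2K = height F + height F
    0≤2K = 0≤+ (0≤height F) (0≤height F)
    -- Chosen so that 2K/σ ≤ ε; the added 1 keeps σ positive when the height is 0.
    σ = (2K + 1ℚ) * recip ε
    0<σ : 0ℚ ℚ.< σ
    0<σ = ℚ-*-pos (ℚ.+-mono-≤-< 0≤2K (ℚ.positive⁻¹ 1ℚ)) (recip-pos 0<ε)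

    1/σ*2K≤ε : recip σ * 2K ℚ.≤ ε
    1/σ*2K≤ε = begin
      recip σ * 2K                               ≤⟨ *-monoˡ (recip σ) (ℚ.<⇒≤ (recip-pos 0<σ)) (p≤p+ε {2K} (ℚ.positive⁻¹ 1ℚ)) ⟩
      recip σ * (2K + 1ℚ)                        ≡⟨ cong (recip σ *_) (ℚ.*-identityʳ (2K + 1ℚ)) ⟨
      recip σ * ((2K + 1ℚ) * 1ℚ)                 ≡⟨ cong (λ u → recip σ * ((2K + 1ℚ) * u)) (*-recip 0<ε) ⟨
      recip σ * ((2K + 1ℚ) * (ε * recip ε))
        ≡⟨ solve 4 (λ r k e i → r :* (k :* (e :* i)) := e :* (k :* i :* r)) refl (recip σ) (2K + 1ℚ) ε (recip ε) ⟩
      ε * (σ * recip σ)                          ≡⟨ cong (ε *_) (*-recip 0<σ) ⟩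
      ε * 1ℚ                                     ≡⟨ ℚ.*-identityʳ ε ⟩
      ε                                          ∎
      where open ℚ.≤-Reasoning

    average≲ : ∀ T (0<T : 0ℝ <ℝ T) → fromℚ (σ + σ) ≤ℝ T →
      ∣ mkReal (inverse T 0<T) *ᴿ integral (mkReal T) -ᴿ ratᴿ c ∣ᴿ ≲ ratᴿ ε
    average≲ T 0<T 2σ≤T = ≲-trans
      (∣∣-resp-≗ (∣∣-+
          (∣∣-* ∣1/T∣≤1/σ (∣∣-+ (potential≲ F Tᴿ 0≤T) (∣∣-neg (potential≲ F 0ᴿ ≲-refl))))
          (∣∣-* (∣ratᴿ∣ c) ∣1/T*T-1∣≤0))
        (λ n → solve 5 (λ i a b c t →
            i :* ((a :+ c :* t) :- (b :+ c :* con 0ℚ)) :- c := i :* (a :- b) :+ c :* (i :* t :- con 1ℚ)) refl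
          (recip (seq T n)) (at (potential F Tᴿ) n) (at (potential F 0ᴿ) n) c (seq T n)))
      (≲-trans
        (≗⇒≲ λ _ → solve 3 (λ r k c → r :* (k :+ k) :+ c :* con 0ℚ := r :* (k :+ k)) refl (recip σ) (height F) ∣ c ∣)
        (ratᴿ-mono-≲ {recip σ * 2K} 1/σ*2K≤ε))
      where
      Tᴿ = mkReal T
      σ≤T : Eventually λ n → σ ℚ.≤ seq T n
      σ≤T = Eventually-map {λ n → σ + σ ℚ.≤ seq T n + σ}
        (λ n 2σ≤ → subst₂ ℚ._≤_ (cancel σ σ) (cancel (seq T n) σ) (ℚ.+-monoˡ-≤ (- σ) 2σ≤)) (2σ≤T σ 0<σ)
        where
        cancel : ∀ p q → p + q - q ≡ p
        cancel = solve 2 (λ p q → p :+ q :- q := p) refl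
      0≤T : 0ᴿ ≲ Tᴿ
      0≤T = Eventually-≲ (Eventually-map {λ n → σ ℚ.≤ seq T n} (λ n → ℚ.≤-trans (ℚ.<⇒≤ 0<σ)) σ≤T)
      ∣1/T∣≤1/σ : ∣ mkReal (inverse T 0<T) ∣ᴿ ≲ ratᴿ (recip σ)
      ∣1/T∣≤1/σ = Eventually-≲ {∣ mkReal (inverse T 0<T) ∣ᴿ} {ratᴿ (recip σ)}
        (Eventually-map {λ n → σ ℚ.≤ seq T n}
          (λ n σ≤Tₙ → subst (ℚ._≤ recip σ)
            (sym (ℚ.0≤p⇒∣p∣≡p (ℚ.<⇒≤ (recip-pos (ℚ.<-≤-trans 0<σ σ≤Tₙ)))))
            (recip-antimono 0<σ σ≤Tₙ)) σ≤T)
      ∣1/T*T-1∣≤0 : ∣ mkReal (inverse T 0<T) *ᴿ Tᴿ -ᴿ 1ᴿ ∣ᴿ ≲ 0ᴿ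
      ∣1/T*T-1∣≤0 = Eventually-≲ {∣ mkReal (inverse T 0<T) *ᴿ Tᴿ -ᴿ 1ᴿ ∣ᴿ} {0ᴿ}
        (Eventually-map {λ n → σ ℚ.≤ seq T n}
          (λ n σ≤Tₙ → ℚ.≤-reflexive (cong (λ u → ∣ u - 1ℚ ∣)
            (trans (ℚ.*-comm (recip (seq T n)) (seq T n)) (*-recip (ℚ.<-≤-trans 0<σ σ≤Tₙ))))) σ≤T)

-- The exponential of the tournament matrix

sum-∣∣-≤ : ∀ {n} (x : Fin n → ℚ) c → (∀ l → ∣ x l ∣ ℚ.≤ c) → ∣ sum x ∣ ℚ.≤ ι n * c
sum-∣∣-≤ {zero}  x c x≤c = ℚ.≤-reflexive (sym (ℚ.*-zeroˡ c))
sum-∣∣-≤ {suc n} x c x≤c = begin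
  ∣ x zero + sum (x ∘ suc) ∣   ≤⟨ ∣∣-+-mono (x≤c zero) (sum-∣∣-≤ (x ∘ suc) c (x≤c ∘ suc)) ⟩
  c + ι n * c                  ≡⟨ solve 2 (λ c n → c :+ n :* c := (con 1ℚ :+ n) :* c) refl c (ι n) ⟩
  (1ℚ + ι n) * c               ≡⟨ cong (_* c) (ι-suc n) ⟨
  ι (suc n) * c                ∎
  where open ℚ.≤-Reasoning

sum-const-sub : ∀ {n} a (x : Fin n → ℚ) → sum (λ l → a - x l) ≡ ι n * a - sum x
sum-const-sub {zero}  a x = solve 1 (λ a → con 0ℚ := con 0ℚ :* a :- con 0ℚ) refl a
sum-const-sub {suc n} a x = trans (cong (a - x zero +_) (sum-const-sub a (x ∘ suc)))
  (trans (solve 4 (λ a y n s → a :- y :+ (n :* a :- s) := (con 1ℚ :+ n) :* a :- (y :+ s)) refl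
    a (x zero) (ι n) (sum (x ∘ suc)))
    (cong (λ u → u * a - sum x) (sym (ι-suc n))))

0≤sum : ∀ {n} (x : Fin n → ℚ) → (∀ l → 0ℚ ℚ.≤ x l) → 0ℚ ℚ.≤ sum x
0≤sum {zero}  x 0≤x = ℚ.≤-refl
0≤sum {suc n} x 0≤x = 0≤+ (0≤x zero) (0≤sum (x ∘ suc) (0≤x ∘ suc))

term≤sum : ∀ {n} (x : Fin n → ℚ) → (∀ l → 0ℚ ℚ.≤ x l) → ∀ j → x j ℚ.≤ sum x
term≤sum x 0≤x zero    = subst (ℚ._≤ sum x) (ℚ.+-identityʳ (x zero))
  (ℚ.+-monoʳ-≤ (x zero) (0≤sum (x ∘ suc) (0≤x ∘ suc)))
term≤sum x 0≤x (suc j) = ℚ.≤-trans (term≤sum (x ∘ suc) (0≤x ∘ suc) j)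
  (subst (ℚ._≤ sum x) (ℚ.+-identityˡ (sum (x ∘ suc))) (ℚ.+-monoˡ-≤ (sum (x ∘ suc)) (0≤x zero)))

-- The real skew-symmetric matrix -iB.
σ : ∀ {n} → Fin n → Fin n → ℚ
σ zero    zero    = 0ℚ
σ zero    (suc l) = - 1ℚ
σ (suc j) zero    = 1ℚ
σ (suc j) (suc l) = σ j l

σ-skew : ∀ {n} (j l : Fin n) → σ j l ≡ - σ l j
σ-skew zero    zero    = refl
σ-skew zero    (suc l) = refl
σ-skew (suc j) zero    = refl
σ-skew (suc j) (suc l) = σ-skew j l

∣σ∣≤1 : ∀ {n} (j l : Fin n) → ∣ σ j l ∣ ℚ.≤ 1ℚ
∣σ∣≤1 zero    zero    = 0≤1
∣σ∣≤1 zero    (suc l) = ℚ.≤-refl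
∣σ∣≤1 (suc j) zero    = ℚ.≤-refl
∣σ∣≤1 (suc j) (suc l) = ∣σ∣≤1 j l

-- From row m to row m + 1 the entry in column m rises from 0 to 1 and the entry in column m + 1
-- from -1 to 0. Rows further down share a leading 1, and deleting it leaves a smaller matrix of the
-- same kind.
σ-rows : ∀ {n} (m : Fin n) (x : Fin (suc n) → ℚ) →
  (sum λ l → σ (suc m) l * x l) - (sum λ l → σ (inject₁ m) l * x l) ≡ x (inject₁ m) + x (suc m)
σ-rows {suc n} zero x = solve 3 (λ a b s →
    (con 1ℚ :* a :+ (con 0ℚ :* b :+ s)) :- (con 0ℚ :* a :+ (con (- 1ℚ) :* b :+ s)) := a :+ b) refl
  (x zero) (x (suc zero)) (sum {n} λ l → - 1ℚ * x (suc (suc l)))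
σ-rows {suc n} (suc m) x = trans
  (solve 3 (λ a s t → (con 1ℚ :* a :+ s) :- (con 1ℚ :* a :+ t) := s :- t) refl
    (x zero) (sum λ l → σ (suc m) l * x (suc l)) (sum λ l → σ (inject₁ m) l * x (suc l)))
  (σ-rows m (x ∘ suc))

p≡-p⇒p≡0 : ∀ {p} → p ≡ - p → p ≡ 0ℚ
p≡-p⇒p≡0 {p} p≡-p = begin
  p                  ≡⟨ solve 1 (λ p → p := con ½ :* (p :+ p)) refl p ⟩
  ½ * (p + p)        ≡⟨ cong (λ u → ½ * (p + u)) p≡-p ⟩
  ½ * (p + - p)      ≡⟨ solve 1 (λ p → con ½ :* (p :- p) := con 0ℚ) refl p ⟩
  0ℚ                 ∎
  where open ≡-Reasoning

-- Interchanging the indices and using skew symmetry turns the form into its own negative. This is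
-- the conservation law behind Σ x_j² = 1.
σ-form≡0 : ∀ {n} (x : Fin n → ℚ) → (sum λ j → sum λ l → x j * (σ j l * x l)) ≡ 0ℚ
σ-form≡0 {n} x = p≡-p⇒p≡0 (begin
  (sum λ j → sum λ l → x j * (σ j l * x l))      ≡⟨ ∑-comm (λ j l → x j * (σ j l * x l)) ⟩
  (sum λ l → sum λ j → x j * (σ j l * x l))
    ≡⟨ sum-cong-≗ (λ l → sum-cong-≗ λ j → trans
         (cong (λ u → x j * (u * x l)) (σ-skew j l))
         (solve 3 (λ a s b → a :* (:- s :* b) := con (- 1ℚ) :* (b :* (s :* a))) refl (x j) (σ l j) (x l))) ⟩
  (sum λ l → sum λ j → - 1ℚ * (x l * (σ l j * x j)))
    ≡⟨ sum-cong-≗ (λ l → *-distribˡ-sum (- 1ℚ) (λ j → x l * (σ l j * x j))) ⟨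
  (sum λ l → - 1ℚ * sum λ j → x l * (σ l j * x j))
    ≡⟨ *-distribˡ-sum (- 1ℚ) (λ l → sum λ j → x l * (σ l j * x j)) ⟨
  - 1ℚ * (sum λ l → sum λ j → x l * (σ l j * x j))
    ≡⟨ solve 1 (λ p → con (- 1ℚ) :* p := :- p) refl (sum λ l → sum λ j → x l * (σ l j * x j)) ⟩
  - (sum λ l → sum λ j → x l * (σ l j * x j))    ∎)
  where open ≡-Reasoning

kronecker : ∀ {n} → Fin n → Fin n → ℚ
kronecker zero    zero    = 1ℚ
kronecker zero    (suc k) = 0ℚ
kronecker (suc j) zero    = 0ℚ
kronecker (suc j) (suc k) = kronecker j k

kronecker-refl : ∀ {n} (j : Fin n) → kronecker j j ≡ 1ℚ
kronecker-refl zero    = refl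
kronecker-refl (suc j) = kronecker-refl j

kronecker-≢ : ∀ {n} (j k : Fin n) → j ≢ k → kronecker j k ≡ 0ℚ
kronecker-≢ zero    zero    j≢k = contradiction refl j≢k
kronecker-≢ zero    (suc k) j≢k = refl
kronecker-≢ (suc j) zero    j≢k = refl
kronecker-≢ (suc j) (suc k) j≢k = kronecker-≢ j k (j≢k ∘ cong suc)

∣kronecker∣≤1 : ∀ {n} (j k : Fin n) → ∣ kronecker j k ∣ ℚ.≤ 1ℚ
∣kronecker∣≤1 zero    zero    = ℚ.≤-refl
∣kronecker∣≤1 zero    (suc k) = 0≤1
∣kronecker∣≤1 (suc j) zero    = 0≤1
∣kronecker∣≤1 (suc j) (suc k) = ∣kronecker∣≤1 j k

kronecker-norm : ∀ {n} (k : Fin n) → (sum λ j → kronecker j k * kronecker j k) ≡ 1ℚ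
kronecker-norm {suc n} zero    = cong (1ℚ * 1ℚ +_) (sum-replicate-zero n)
kronecker-norm {suc n} (suc k) = cong (0ℚ * 0ℚ +_) (kronecker-norm k)

σ-power : ∀ {n} → ℕ → Fin n → Fin n → ℚ
σ-power zero    j k = kronecker j k
σ-power (suc r) j k = sum λ l → σ j l * σ-power r l k

∣σ-power∣≤ : ∀ {n} r (j k : Fin n) → ∣ σ-power r j k ∣ ℚ.≤ ι n ^ r
∣σ-power∣≤ zero    j k = ∣kronecker∣≤1 j k
∣σ-power∣≤ {n} (suc r) j k = sum-∣∣-≤ (λ l → σ j l * σ-power r l k) (ι n ^ r) λ l →
  ℚ.≤-trans (∣∣-*-mono {σ j l} {σ-power r l k} 0≤1 (∣σ∣≤1 j l) (∣σ-power∣≤ r l k))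
    (ℚ.≤-reflexive (ℚ.*-identityˡ (ι n ^ r)))

-- Factorials and the growth of the exponential coefficients

1/!_ : ℕ → ℚ
1/! r = (ℤ.+ 1 ℚ./ (r !)) {{r ℕ.!≢0}}

ι!*1/! : ∀ r → ι (r !) * 1/! r ≡ 1ℚ
ι!*1/! r = ι-*-1/ (r !) {{r ℕ.!≢0}}

0≤1/! : ∀ r → 0ℚ ℚ.≤ 1/! r
0≤1/! r = ℚ.nonNegative⁻¹ (1/! r) {{ℚ.normalize-nonNeg 1 (r !) {{r ℕ.!≢0}}}}

1/!-suc : ∀ r → ι (suc r) * 1/! (suc r) ≡ 1/! r
1/!-suc r = begin
  s * u                   ≡⟨ ℚ.*-identityʳ (s * u) ⟨
  s * u * 1ℚ              ≡⟨ cong (s * u *_) (ι!*1/! r) ⟨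
  s * u * (ι (r !) * v)   ≡⟨ solve 4 (λ s u f v → s :* u :* (f :* v) := s :* f :* u :* v) refl s u (ι (r !)) v ⟩
  s * ι (r !) * u * v     ≡⟨ cong (λ w → w * u * v) (ι-* (suc r) (r !)) ⟨
  ι (suc r !) * u * v     ≡⟨ cong (_* v) (ι!*1/! (suc r)) ⟩
  1ℚ * v                  ≡⟨ ℚ.*-identityˡ v ⟩
  v                       ∎
  where
  open ≡-Reasoning
  s = ι (suc r)
  u = 1/! (suc r)
  v = 1/! r

-- Up to exponent m the factor m^m alone suffices. Beyond it, every step multiplies the left side by
-- m and the right side by a number above m.
m^r≤m^m*r! : ∀ m .{{_ : ℕ.NonZero m}} r → m ℕ.^ r ≤ m ℕ.^ m ℕ.* r !
m^r≤m^m*r! m zero    = ℕ.≤-trans (ℕ.m^n>0 m m) (ℕ.≤-reflexive (sym (ℕ.*-identityʳ (m ℕ.^ m))))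
m^r≤m^m*r! m (suc r) with suc r ℕ.≤? m
... | yes r<m = ℕ.≤-trans (ℕ.^-monoʳ-≤ m r<m) (ℕ.m≤m*n (m ℕ.^ m) (suc r !) {{suc r ℕ.!≢0}})
... | no  r≮m = begin
  m ℕ.* m ℕ.^ r                        ≤⟨ ℕ.*-mono-≤ (ℕ.<⇒≤ (ℕ.≰⇒> r≮m)) (m^r≤m^m*r! m r) ⟩
  suc r ℕ.* (m ℕ.^ m ℕ.* r !)          ≡⟨ ℕ.*-assoc (suc r) (m ℕ.^ m) (r !) ⟨
  suc r ℕ.* m ℕ.^ m ℕ.* r !            ≡⟨ cong (ℕ._* r !) (ℕ.*-comm (suc r) (m ℕ.^ m)) ⟩
  m ℕ.^ m ℕ.* suc r ℕ.* r !            ≡⟨ ℕ.*-assoc (m ℕ.^ m) (suc r) (r !) ⟩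
  m ℕ.^ m ℕ.* suc r !                  ∎
  where open ℕ.≤-Reasoning

exp-coefficient-bound : ∀ Y → 0ℚ ℚ.≤ Y → ∃ λ C → ∀ r → Y ^ r * 1/! r ℚ.≤ C
exp-coefficient-bound Y 0≤Y = let m , Y≤m = archimedean Y in
  -- The successor makes the base nonzero even for m = 0.
  ι (suc m ℕ.^ suc m) , λ r → bound m r (ℚ.≤-trans Y≤m (ι-mono-≤ (ℕ.n≤1+n m)))
  where
  bound : ∀ m r → Y ℚ.≤ ι (suc m) → Y ^ r * 1/! r ℚ.≤ ι (suc m ℕ.^ suc m)
  bound m r Y≤M = begin
    Y ^ r * 1/! r                    ≤⟨ *-monoʳ (1/! r) (0≤1/! r) (^-mono-≤ 0≤Y Y≤M r) ⟩
    ι M ^ r * 1/! r                  ≡⟨ cong (_* 1/! r) (ι-^ M r) ⟩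
    ι (M ℕ.^ r) * 1/! r              ≤⟨ *-monoʳ (1/! r) (0≤1/! r) (ι-mono-≤ (m^r≤m^m*r! M r)) ⟩
    ι (M ℕ.^ M ℕ.* r !) * 1/! r      ≡⟨ cong (_* 1/! r) (ι-* (M ℕ.^ M) (r !)) ⟩
    ι (M ℕ.^ M) * ι (r !) * 1/! r    ≡⟨ ℚ.*-assoc (ι (M ℕ.^ M)) (ι (r !)) (1/! r) ⟩
    ι (M ℕ.^ M) * (ι (r !) * 1/! r)  ≡⟨ cong (ι (M ℕ.^ M) *_) (ι!*1/! r) ⟩
    ι (M ℕ.^ M) * 1ℚ                 ≡⟨ ℚ.*-identityʳ (ι (M ℕ.^ M)) ⟩
    ι (M ℕ.^ M)                      ∎
    where
    open ℚ.≤-Reasoning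
    M = suc m

exp-coefficient : ∀ {n} → Fin n → Fin n → ℕ → ℚ
exp-coefficient j k r = 1/! r * σ-power r j k

exp-entire : ∀ {n} (j k : Fin n) → Entire (exp-coefficient j k)
exp-entire {n} j k Y 0≤Y = let C , bound = exp-coefficient-bound Z 0≤Z in C , estimate C bound
  where
  0≤n : 0ℚ ℚ.≤ ι n
  0≤n = ι-mono-≤ {0} {n} ℕ.z≤n
  -- The factor n pays for the growth of S^r, and the doubling of Y for the required ½^r.
  Z = ι n * (Y + Y)
  0≤Z = 0≤* 0≤n (0≤+ 0≤Y 0≤Y)
  estimate : ∀ C → (∀ r → Z ^ r * 1/! r ℚ.≤ C) → ∀ r → ∣ exp-coefficient j k r ∣ * Y ^ r ℚ.≤ C * ½ ^ r
  estimate C bound r = begin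
    ∣ 1/! r * σ-power r j k ∣ * Y ^ r
      ≤⟨ *-monoʳ (Y ^ r) (0≤^ 0≤Y r) (∣∣-*-mono {1/! r} {σ-power r j k} (0≤1/! r)
           (ℚ.≤-reflexive (ℚ.0≤p⇒∣p∣≡p (0≤1/! r))) (∣σ-power∣≤ r j k)) ⟩
    1/! r * ι n ^ r * Y ^ r
      ≡⟨ ℚ.*-assoc (1/! r) (ι n ^ r) (Y ^ r) ⟩
    1/! r * (ι n ^ r * Y ^ r)
      ≡⟨ cong (1/! r *_) (^-distrib-* (ι n) Y r) ⟨
    1/! r * (ι n * Y) ^ r
      ≡⟨ cong (λ u → 1/! r * u ^ r)
           (solve 2 (λ n y → n :* y := n :* (y :+ y) :* con ½) refl (ι n) Y) ⟩
    1/! r * (Z * ½) ^ r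
      ≡⟨ cong (1/! r *_) (^-distrib-* Z ½ r) ⟩
    1/! r * (Z ^ r * ½ ^ r)
      ≡⟨ solve 3 (λ f z h → f :* (z :* h) := z :* f :* h) refl (1/! r) (Z ^ r) (½ ^ r) ⟩
    Z ^ r * 1/! r * ½ ^ r
      ≤⟨ *-monoʳ (½ ^ r) (0≤^ 0≤½ r) (bound r) ⟩
    C * ½ ^ r ∎
    where open ℚ.≤-Reasoning

-- The differential equation x′ = S x on the level of coefficients, from (r+1)/(r+1)! = 1/r! and
-- S^(r+1) = S S^r.
exp-derivCoeff : ∀ {n} (j k : Fin n) r →
  derivCoeff (exp-coefficient j k) r ≡ sum λ l → σ j l * exp-coefficient l k r
exp-derivCoeff j k r = begin
  ι (suc r) * (1/! (suc r) * s)                ≡⟨ ℚ.*-assoc (ι (suc r)) (1/! (suc r)) s ⟨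
  ι (suc r) * 1/! (suc r) * s                  ≡⟨ cong (_* s) (1/!-suc r) ⟩
  1/! r * s                                    ≡⟨ *-distribˡ-sum (1/! r) (λ l → σ j l * σ-power r l k) ⟩
  (sum λ l → 1/! r * (σ j l * σ-power r l k))
    ≡⟨ sum-cong-≗ (λ l → solve 3 (λ f s p → f :* (s :* p) := s :* (f :* p)) refl (1/! r) (σ j l) (σ-power r l k)) ⟩
  (sum λ l → σ j l * exp-coefficient l k r)    ∎
  where
  open ≡-Reasoning
  s = sum λ l → σ j l * σ-power r l k

powerSum-sum : ∀ {n} (c : Fin n → ℚ) (a : Fin n → ℕ → ℚ) p t →
  powerSum (λ r → sum λ l → c l * a l r) p t ≡ sum λ l → c l * powerSum (a l) p t
powerSum-sum {n} c a zero t = sym (trans (sum-cong-≗ λ l → ℚ.*-zeroʳ (c l)) (sum-replicate-zero n))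
powerSum-sum c a (suc p) t = begin
  powerSum (λ r → sum λ l → c l * a l r) p t + (sum λ l → c l * a l p) * t ^ p
    ≡⟨ cong₂ _+_ (powerSum-sum c a p t) (trans (ℚ.*-comm (sum λ l → c l * a l p) (t ^ p))
         (*-distribˡ-sum (t ^ p) (λ l → c l * a l p))) ⟩
  (sum λ l → c l * powerSum (a l) p t) + (sum λ l → t ^ p * (c l * a l p))
    ≡⟨ ∑-distrib-+ (λ l → c l * powerSum (a l) p t) (λ l → t ^ p * (c l * a l p)) ⟨
  (sum λ l → c l * powerSum (a l) p t + t ^ p * (c l * a l p))
    ≡⟨ sum-cong-≗ (λ l → solve 4 (λ c s a w → c :* s :+ w :* (c :* a) := c :* (s :+ a :* w)) refl
         (c l) (powerSum (a l) p t) (a l p) (t ^ p)) ⟩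
  (sum λ l → c l * powerSum (a l) (suc p) t) ∎
  where open ≡-Reasoning

-- The empty power sum is 0, so the initial value appears only from index 1 on; accordingly
-- `norm²-at-0` discards index 0.
powerSum-at-0 : ∀ a p → powerSum a (suc p) 0ℚ ≡ a 0
powerSum-at-0 a zero    = solve 1 (λ a → con 0ℚ :+ a :* con 1ℚ := a) refl (a 0)
powerSum-at-0 a (suc p) = trans (cong₂ (λ u w → u + a (suc p) * w) (powerSum-at-0 a p) (ℚ.*-zeroˡ (0ℚ ^ p)))
  (solve 2 (λ a b → a :+ b :* con 0ℚ := a) refl (a 0) (a (suc p)))

-- Mixing

evolution : ∀ {n} → Fin n → Fin n → Real → Real
evolution j k = powerSeries (exp-coefficient j k) (exp-entire j k)

-- Entry (j, k) of S exp(tS), the right-hand side of the differential equation.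
evolution′ : ∀ {n} → Fin n → Fin n → Real → Real
evolution′ j k t = sumᴿ λ l → ratᴿ (σ j l) *ᴿ evolution l k t

at-evolution′ : ∀ {n} (j k : Fin n) t p →
                at (evolution′ j k t) p ≡ sum λ l → σ j l * at (evolution l k t) p
at-evolution′ j k t p = at-sumᴿ (λ l → ratᴿ (σ j l) *ᴿ evolution l k t) p

-- All entries are truncated at the same index, so the coefficient identity `exp-derivCoeff` passes
-- to the approximations without error.
evolution-differentiable : ∀ {n} (j k : Fin n) → Differentiable (evolution j k) (evolution′ j k)
evolution-differentiable j k = Differentiable-powerSeries (exp-coefficient j k) (exp-entire j k) λ t p →
  trans (at-evolution′ j k t p)
    (trans (sym (powerSum-sum (σ j) (λ l → exp-coefficient l k) p (at t p)))
      (partialSum-cong (λ r → cong (_* at t p ^ r) (sym (exp-derivCoeff j k r))) p))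

square : Real → Real
square x = x *ᴿ x

norm² : ∀ {n} → Fin n → Real → Real
norm² k t = sumᴿ λ j → square (evolution j k t)

at-norm² : ∀ {n} (k : Fin n) t p →
           at (norm² k t) p ≡ sum λ j → at (evolution j k t) p * at (evolution j k t) p
at-norm² k t p = at-sumᴿ (λ j → square (evolution j k t)) p

-- The product rule gives twice the quadratic form of S at x, and `σ-form≡0` applies to the rational
-- approximations index by index.
norm²-differentiable : ∀ {n} (k : Fin n) → Differentiable (norm² k) (λ _ → 0ᴿ)
norm²-differentiable {n} k = Differentiable-≗ vanishes
  (Differentiable-sum λ j → Differentiable-* (evolution-differentiable j k) (evolution-differentiable j k))
  where
  open ≡-Reasoning
  vanishes : ∀ t p →
    at (sumᴿ λ j → evolution′ j k t *ᴿ evolution j k t +ᴿ evolution j k t *ᴿ evolution′ j k t) p ≡ 0ℚ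
  vanishes t p = begin
    at (sumᴿ λ j → evolution′ j k t *ᴿ evolution j k t +ᴿ evolution j k t *ᴿ evolution′ j k t) p
      ≡⟨ at-sumᴿ (λ j → evolution′ j k t *ᴿ evolution j k t +ᴿ evolution j k t *ᴿ evolution′ j k t) p ⟩
    (sum λ j → at (evolution′ j k t) p * x j + x j * at (evolution′ j k t) p)
      ≡⟨ sum-cong-≗ (λ j → cong₂ _+_
           (trans (ℚ.*-comm (at (evolution′ j k t) p) (x j)) (expand j)) (expand j)) ⟩
    (sum λ j → u j + u j)
      ≡⟨ ∑-distrib-+ u u ⟩
    sum u + sum u
      ≡⟨ cong₂ _+_ (σ-form≡0 x) (σ-form≡0 x) ⟩
    0ℚ ∎
    where
    x : Fin n → ℚ
    x j = at (evolution j k t) p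
    u : Fin n → ℚ
    u j = sum λ l → x j * (σ j l * x l)
    expand : ∀ j → x j * at (evolution′ j k t) p ≡ u j
    expand j = trans (cong (x j *_) (at-evolution′ j k t p)) (*-distribˡ-sum (x j) (λ l → σ j l * x l))

norm²-at-0 : ∀ {n} (k : Fin n) → ∣ norm² k 0ᴿ -ᴿ 1ᴿ ∣ᴿ ≲ 0ᴿ
norm²-at-0 k = Eventually-≲ {∣ norm² k 0ᴿ -ᴿ 1ᴿ ∣ᴿ} {0ᴿ}
  (Eventually-suc {λ p → at (∣ norm² k 0ᴿ -ᴿ 1ᴿ ∣ᴿ) p ℚ.≤ 0ℚ}
    (0 , λ p _ → ℚ.≤-reflexive (cong (λ u → ∣ u - 1ℚ ∣) (at-suc p))))
  where
  initial : ∀ j p → at (evolution j k 0ᴿ) (suc p) ≡ kronecker j k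
  initial j p = trans (powerSum-at-0 (exp-coefficient j k) p) (ℚ.*-identityˡ (kronecker j k))
  at-suc : ∀ p → at (norm² k 0ᴿ) (suc p) ≡ 1ℚ
  at-suc p = trans (at-norm² k 0ᴿ (suc p))
    (trans (sum-cong-≗ λ j → cong₂ _*_ (initial j p) (initial j p)) (kronecker-norm k))

norm²≈1 : ∀ {n} (k : Fin n) t → 0ᴿ ≲ t → ∣ norm² k t -ᴿ 1ᴿ ∣ᴿ ≲ 0ᴿ
norm²≈1 k t 0≤t = ≲-respʳ-≗
  (∣∣-resp-≗ (∣∣-+ (zero-derivative⇒constant (norm²-differentiable k) t 0≤t) (norm²-at-0 k))
    (λ p → solve 2 (λ a b → a :- con 1ℚ := (a :- b) :+ (b :- con 1ℚ)) refl (at (norm² k t) p) (at (norm² k 0ᴿ) p)))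
  (λ _ → refl)

norm²≲1 : ∀ {n} (k : Fin n) t → 0ᴿ ≲ t → norm² k t ≲ 1ᴿ
norm²≲1 k t 0≤t = ≲-trans
  (≗⇒≲ λ p → solve 1 (λ a → a := (a :- con 1ℚ) :+ con 1ℚ) refl (at (norm² k t) p))
  (≲-trans (+-mono-≲ (≲-trans (≲∣∣ (norm² k t -ᴿ 1ᴿ)) (norm²≈1 k t 0≤t)) (≲-refl {1ᴿ})) (≗⇒≲ λ _ → refl))

0≤p² : ∀ p → 0ℚ ℚ.≤ p * p
0≤p² p = subst (0ℚ ℚ.≤_) ∣p∣²≡p² (0≤* (ℚ.0≤∣p∣ p) (ℚ.0≤∣p∣ p))
  where
  ∣p∣²≡p² : ∣ p ∣ * ∣ p ∣ ≡ p * p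
  ∣p∣²≡p² with ℚ.∣p∣≡p∨∣p∣≡-p p
  ... | inj₁ eq = cong₂ _*_ eq eq
  ... | inj₂ eq = trans (cong₂ _*_ eq eq) (solve 1 (λ p → :- p :* :- p := p :* p) refl p)

square≲norm² : ∀ {n} (j k : Fin n) t → square (evolution j k t) ≲ norm² k t
square≲norm² j k t = pointwise-≲ λ p → subst (at (square (evolution j k t)) p ℚ.≤_) (sym (at-norm² k t p))
  (term≤sum (λ j → at (evolution j k t) p * at (evolution j k t) p) (λ j → 0≤p² (at (evolution j k t) p)) j)

-- Subtraction as addition of a multiple by -1, so that closure under sums and rational multiples
-- also covers differences.
_⊝_ : Real → Real → Real
x ⊝ y = x +ᴿ ratᴿ (- 1ℚ) *ᴿ y

-- ½ (x_{m+1} − x_m)² is a primitive of x_{m+1}² − x_m², because x_{m+1}′ − x_m′ = x_m + x_{m+1}.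
neighbours : ∀ {n} (k : Fin (suc n)) (m : Fin n) →
  BoundedPrimitive (λ t → square (evolution (suc m) k t) ⊝ square (evolution (inject₁ m) k t))
neighbours k m = record
  { potential      = λ t → ratᴿ ½ *ᴿ square (w t)
  ; differentiable = Differentiable-≗ derivative (Differentiable-scale ½ (Differentiable-* dw dw))
  ; height         = 1ℚ + 1ℚ
  ; 0≤height       = 0≤+ 0≤1 0≤1
  ; potential≲     = λ t 0≤t → ≲-trans
      (pointwise-≲ λ p → bound (at (x t) p) (at (y t) p))
      (≲-respʳ-≗ (+-mono-≲ (≲-trans (square≲norm² (suc m) k t) (norm²≲1 k t 0≤t))
        (≲-trans (square≲norm² (inject₁ m) k t) (norm²≲1 k t 0≤t))) λ _ → refl)
  }
  where
  x x′ y y′ w : Real → Real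
  x  = evolution (suc m) k
  x′ = evolution′ (suc m) k
  y  = evolution (inject₁ m) k
  y′ = evolution′ (inject₁ m) k
  w t = x t ⊝ y t
  dw : Differentiable w (λ t → x′ t ⊝ y′ t)
  dw = Differentiable-+ (evolution-differentiable (suc m) k)
    (Differentiable-scale (- 1ℚ) (evolution-differentiable (inject₁ m) k))

  derivative : ∀ t p → at (ratᴿ ½ *ᴿ ((x′ t ⊝ y′ t) *ᴿ w t +ᴿ w t *ᴿ (x′ t ⊝ y′ t))) p ≡ at (square (x t) ⊝ square (y t)) p
  derivative t p = begin
    ½ * ((a′ + - 1ℚ * b′) * (a + - 1ℚ * b) + (a + - 1ℚ * b) * (a′ + - 1ℚ * b′))
      ≡⟨ solve 4 (λ a b a′ b′ →
           con ½ :* ((a′ :+ con (- 1ℚ) :* b′) :* (a :+ con (- 1ℚ) :* b) :+ (a :+ con (- 1ℚ) :* b) :* (a′ :+ con (- 1ℚ) :* b′))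
             := (a′ :- b′) :* (a :- b)) refl a b a′ b′ ⟩
    (a′ - b′) * (a - b)
      ≡⟨ cong (_* (a - b)) (trans (cong₂ _-_ (at-evolution′ (suc m) k t p) (at-evolution′ (inject₁ m) k t p))
           (σ-rows m (λ l → at (evolution l k t) p))) ⟩
    (b + a) * (a - b)
      ≡⟨ solve 2 (λ a b → (b :+ a) :* (a :- b) := a :* a :+ con (- 1ℚ) :* (b :* b)) refl a b ⟩
    a * a + - 1ℚ * (b * b) ∎
    where
    open ≡-Reasoning
    a  = at (x t) p
    a′ = at (x′ t) p
    b  = at (y t) p
    b′ = at (y′ t) p

  -- By the parallelogram identity, adding ½(a + b)² completes the potential to a² + b². Each of the
  -- two squares is at most Σ x_j² = 1, hence the height 2.
  bound : ∀ a b → ∣ ½ * ((a + - 1ℚ * b) * (a + - 1ℚ * b)) ∣ ℚ.≤ a * a + b * b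
  bound a b = begin
    ∣ ½ * (d * d) ∣                        ≡⟨ ℚ.0≤p⇒∣p∣≡p (0≤* 0≤½ (0≤p² d)) ⟩
    ½ * (d * d)                            ≡⟨ ℚ.+-identityʳ (½ * (d * d)) ⟨
    ½ * (d * d) + 0ℚ                       ≤⟨ ℚ.+-monoʳ-≤ (½ * (d * d)) (0≤* 0≤½ (0≤p² (a + b))) ⟩
    ½ * (d * d) + ½ * ((a + b) * (a + b))
      ≡⟨ solve 2 (λ a b → let d = a :+ con (- 1ℚ) :* b in
           con ½ :* (d :* d) :+ con ½ :* ((a :+ b) :* (a :+ b)) := a :* a :+ b :* b) refl a b ⟩
    a * a + b * b                          ∎
    where
    open ℚ.≤-Reasoning
    d = a + - 1ℚ * b

-- Telescoping along 0, 1, ..., j, one pair of neighbours at a time. Row 0 is the reference through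
-- which any two rows can be compared.
from-first : ∀ {n} (k j : Fin (suc n)) →
  BoundedPrimitive (λ t → square (evolution j k t) ⊝ square (evolution zero k t))
from-first {n} k = <-weakInduction
  (λ j → BoundedPrimitive (λ t → square (evolution j k t) ⊝ square (evolution zero k t)))
  (BoundedPrimitive-≗
    (λ t p → solve 1 (λ a → con 0ℚ := a :+ con (- 1ℚ) :* a) refl (at (square (evolution {suc n} zero k t)) p))
    BoundedPrimitive-0)
  (λ m ih → BoundedPrimitive-≗
    (λ t p → solve 3 (λ a b c → (a :+ con (- 1ℚ) :* b) :+ (b :+ con (- 1ℚ) :* c) := a :+ con (- 1ℚ) :* c) refl
      (at (square (evolution (suc m) k t)) p) (at (square (evolution (inject₁ m) k t)) p)
      (at (square (evolution zero k t)) p))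
    (BoundedPrimitive-+ (neighbours k m) ih))

1/n : ∀ n → .{{ℕ.NonZero n}} → ℚ
1/n n = ℤ.+ 1 ℚ./ n

-- With N the order of the matrix, x_j² - 1/N is the mean over l of x_j² - x_l², plus (Σ x_l² -
-- 1)/N. Each difference is taken through row 0, and the last summand is null for nonnegative times.
deviation : ∀ {n} (j k : Fin (suc n)) →
  BoundedPrimitive (λ t → square (evolution j k t) -ᴿ ratᴿ (1/n (suc n)))
deviation {n} j k = BoundedPrimitive-cong {f = λ t → ratᴿ 1/N *ᴿ (sumᴿ λ l → difference l t)}
  (λ t 0≤t → ≲-respʳ-≗
    (∣∣-resp-≗ (∣∣-* (∣ratᴿ∣ (- 1/N)) (norm²≈1 k t 0≤t)) (rearrange t))
    (λ _ → ℚ.*-zeroʳ ∣ - 1/N ∣))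
  (BoundedPrimitive-scale 1/N (BoundedPrimitive-sum λ l →
    BoundedPrimitive-+ (from-first k j) (BoundedPrimitive-scale (- 1ℚ) (from-first k l))))
  where
  1/N = 1/n (suc n)
  difference : Fin (suc n) → Real → Real
  difference l t = (square (evolution j k t) ⊝ square (evolution zero k t))
    ⊝ (square (evolution l k t) ⊝ square (evolution zero k t))
  open ≡-Reasoning
  rearrange : ∀ t p →
    at (ratᴿ 1/N *ᴿ (sumᴿ λ l → difference l t) -ᴿ (square (evolution j k t) -ᴿ ratᴿ 1/N)) p
      ≡ - 1/N * (at (norm² k t) p - 1ℚ)
  rearrange t p = begin
    1/N * at (sumᴿ λ l → difference l t) p - (a - 1/N)
      ≡⟨ cong (λ u → 1/N * u - (a - 1/N)) (begin
           at (sumᴿ λ l → difference l t) p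
             ≡⟨ at-sumᴿ (λ l → difference l t) p ⟩
           (sum λ l → (a + - 1ℚ * z) + - 1ℚ * (b l + - 1ℚ * z))
             ≡⟨ sum-cong-≗ (λ l → solve 3 (λ a b z →
                  (a :+ con (- 1ℚ) :* z) :+ con (- 1ℚ) :* (b :+ con (- 1ℚ) :* z) := a :- b) refl a (b l) z) ⟩
           (sum λ l → a - b l)
             ≡⟨ sum-const-sub a b ⟩
           ι (suc n) * a - sum b
             ≡⟨ cong (λ u → ι (suc n) * a - u) (at-norm² k t p) ⟨
           ι (suc n) * a - at (norm² k t) p ∎) ⟩
    1/N * (ι (suc n) * a - at (norm² k t) p) - (a - 1/N)
      ≡⟨ solve 4 (λ i n a s → i :* (n :* a :- s) :- (a :- i) := (n :* i :- con 1ℚ) :* a :+ :- i :* (s :- con 1ℚ)) refl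
           1/N (ι (suc n)) a (at (norm² k t) p) ⟩
    (ι (suc n) * 1/N - 1ℚ) * a + - 1/N * (at (norm² k t) p - 1ℚ)
      ≡⟨ cong (λ u → (u - 1ℚ) * a + - 1/N * (at (norm² k t) p - 1ℚ)) (ι-*-1/ (suc n)) ⟩
    (1ℚ - 1ℚ) * a + - 1/N * (at (norm² k t) p - 1ℚ)
      ≡⟨ solve 2 (λ a s → (con 1ℚ :- con 1ℚ) :* a :+ s := s) refl a (- 1/N * (at (norm² k t) p - 1ℚ)) ⟩
    - 1/N * (at (norm² k t) p - 1ℚ) ∎
    where
    a = at (square (evolution j k t)) p
    z = at (square (evolution {suc n} zero k t)) p
    b : Fin (suc n) → ℚ
    b l = at (square (evolution l k t)) p

-- Comparison with the complex definitions

σ-< : ∀ {n} (j k : Fin n) → j Fin.< k → σ j k ≡ - 1ℚ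
σ-< zero    (suc k) _           = refl
σ-< (suc j) (suc k) (ℕ.s≤s j<k) = σ-< j k j<k

σ-> : ∀ {n} (j k : Fin n) → k Fin.< j → σ j k ≡ 1ℚ
σ-> j k k<j = trans (σ-skew j k) (cong -_ (σ-< k j k<j))

σ-diagonal : ∀ {n} (j : Fin n) → σ j j ≡ 0ℚ
σ-diagonal zero    = refl
σ-diagonal (suc j) = σ-diagonal j

re-tournament : ∀ {n} (j k : Fin n) p → seq (re (transitiveTournament n j k)) p ≡ 0ℚ
re-tournament j k p with Fin.<-cmp j k
... | tri< _ _ _ = refl
... | tri≈ _ _ _ = refl
... | tri> _ _ _ = refl

-- B = iS, so S appears as the imaginary part of B, and -itB = tS is real.
im-tournament : ∀ {n} (j k : Fin n) p → seq (im (transitiveTournament n j k)) p ≡ σ j k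
im-tournament j k p with Fin.<-cmp j k
... | tri< j<k _ _ = sym (σ-< j k j<k)
... | tri≈ _ j≡k _ = sym (trans (cong (σ j) (sym j≡k)) (σ-diagonal j))
... | tri> _ _ k<j = sym (σ-> j k k<j)

re-1ᴹ : ∀ {n} (j k : Fin n) p → seq (re (1ᴹ j k)) p ≡ kronecker j k
re-1ᴹ j k p with j Fin.≟ k
... | yes j≡k = sym (trans (cong (kronecker j) (sym j≡k)) (kronecker-refl j))
... | no  j≢k = sym (kronecker-≢ j k j≢k)

im-1ᴹ : ∀ {n} (j k : Fin n) p → seq (im (1ᴹ j k)) p ≡ 0ℚ
im-1ᴹ j k p with j Fin.≟ k
... | yes _ = refl
... | no  _ = refl

module Exponential {n : ℕ} (t : ℝ) where

  generator : Matrix n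
  generator = (-ℂ (i *ℂ fromℝ t)) · transitiveTournament n

  re-generator : ∀ j k p → seq (re (generator j k)) p ≡ σ j k * seq t p
  re-generator j k p = trans
    (cong (λ u → - (0ℚ * seq t p - 1ℚ * 0ℚ) * seq (re (transitiveTournament n j k)) p
               - - (0ℚ * 0ℚ + 1ℚ * seq t p) * u) (im-tournament j k p))
    (solve 3 (λ t r s → :- (con 0ℚ :* t :- con 1ℚ :* con 0ℚ) :* r :- :- (con 0ℚ :* con 0ℚ :+ con 1ℚ :* t) :* s
                 := s :* t) refl (seq t p) (seq (re (transitiveTournament n j k)) p) (σ j k))

  im-generator : ∀ j k p → seq (im (generator j k)) p ≡ 0ℚ
  im-generator j k p = trans
    (cong (λ u → - (0ℚ * seq t p - 1ℚ * 0ℚ) * seq (im (transitiveTournament n j k)) p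
               + - (0ℚ * 0ℚ + 1ℚ * seq t p) * u) (re-tournament j k p))
    (solve 2 (λ t s → :- (con 0ℚ :* t :- con 1ℚ :* con 0ℚ) :* s :+ :- (con 0ℚ :* con 0ℚ :+ con 1ℚ :* t) :* con 0ℚ
                 := con 0ℚ) refl (seq t p) (seq (im (transitiveTournament n j k)) p))

  im-power : ∀ r j k p → seq (im ((generator ^ᴹ r) j k)) p ≡ 0ℚ
  im-power zero    j k p = im-1ᴹ j k p
  im-power (suc r) j k p = seq-im-sumℂ {z = λ l → generator j l *ℂ (generator ^ᴹ r) l k} p λ l → trans
    (cong₂ (λ u v → seq (re (generator j l)) p * u + v * seq (re ((generator ^ᴹ r) l k)) p)
      (im-power r l k p) (im-generator j l p))
    (solve 2 (λ a b → a :* con 0ℚ :+ con 0ℚ :* b := con 0ℚ) refl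
      (seq (re (generator j l)) p) (seq (re ((generator ^ᴹ r) l k)) p))

  -- The imaginary parts are exactly 0 at each index, so complex matrix products reduce to rational
  -- ones and (tS)^r releases the scalar t^r.
  re-power : ∀ r j k p → seq (re ((generator ^ᴹ r) j k)) p ≡ σ-power r j k * seq t p ^ r
  re-power zero    j k p = trans (re-1ᴹ j k p) (sym (ℚ.*-identityʳ (kronecker j k)))
  re-power (suc r) j k p = begin
    seq (re ((generator ^ᴹ suc r) j k)) p
      ≡⟨ seq-re-sumℂ {z = λ l → generator j l *ℂ (generator ^ᴹ r) l k} p (λ l → trans
           (cong₂ (λ u v → seq (re (generator j l)) p * u - v * seq (im ((generator ^ᴹ r) l k)) p)
             (re-power r l k p) (im-generator j l p))
           (trans (cong (λ u → u * (σ-power r l k * s ^ r) - 0ℚ * seq (im ((generator ^ᴹ r) l k)) p)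
               (re-generator j l p))
             (solve 5 (λ a s b w c → a :* s :* (b :* w) :- con 0ℚ :* c := s :* w :* (a :* b)) refl
               (σ j l) s (σ-power r l k) (s ^ r) (seq (im ((generator ^ᴹ r) l k)) p)))) ⟩
    (sum λ l → s * s ^ r * (σ j l * σ-power r l k))
      ≡⟨ *-distribˡ-sum (s * s ^ r) (λ l → σ j l * σ-power r l k) ⟨
    s * s ^ r * σ-power (suc r) j k
      ≡⟨ ℚ.*-comm (s * s ^ r) (σ-power (suc r) j k) ⟩
    σ-power (suc r) j k * (s * s ^ r) ∎
    where
    open ≡-Reasoning
    s = seq t p

  re-partialSum : ∀ m j k p → seq (re (expPartialSum generator m j k)) p ≡ powerSum (exp-coefficient j k) m (seq t p)
  re-partialSum zero    j k p = refl
  re-partialSum (suc m) j k p = cong₂ _+_ (re-partialSum m j k p) (trans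
    (cong (λ u → 1/! m * u - 0ℚ * seq (im ((generator ^ᴹ m) j k)) p) (re-power m j k p))
    (solve 4 (λ f s w c → f :* (s :* w) :- con 0ℚ :* c := f :* s :* w) refl
      (1/! m) (σ-power m j k) (seq t p ^ m) (seq (im ((generator ^ᴹ m) j k)) p)))

  im-partialSum : ∀ m j k p → seq (im (expPartialSum generator m j k)) p ≡ 0ℚ
  im-partialSum zero    j k p = refl
  im-partialSum (suc m) j k p = cong₂ _+_ (im-partialSum m j k p) (trans
    (cong (λ u → 1/! m * u + 0ℚ * seq (re ((generator ^ᴹ m) j k)) p) (im-power m j k p))
    (solve 2 (λ f c → f :* con 0ℚ :+ con 0ℚ :* c := con 0ℚ) refl (1/! m) (seq (re ((generator ^ᴹ m) j k)) p)))

  isMatrixExp : IsMatrixExp generator (λ j k → fromℝ (real (evolution j k (mkReal t))))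
  isMatrixExp j k ε 0<ε = Eventually-map
    (λ m close → Modulus-intro {ε} {expPartialSum generator m j k -ℂ U}
      (Eventually-≲ {∣ mkReal (re (expPartialSum generator m j k -ℂ U)) ∣ᴿ} {ratᴿ ε}
        (Eventually-map {λ p → ∣ powerSum (exp-coefficient j k) m (seq t p) - at (evolution j k (mkReal t)) p ∣ ℚ.≤ ε}
          (λ p → subst (λ u → ∣ u - at (evolution j k (mkReal t)) p ∣ ℚ.≤ ε) (sym (re-partialSum m j k p))) close))
      (∣∣-zero λ p → cong (_- 0ℚ) (im-partialSum m j k p)))
    (powerSeries-converges (exp-coefficient j k) (exp-entire j k) (mkReal t) ε 0<ε)
    where U = fromℝ (real (evolution j k (mkReal t)))

module Mean {n : ℕ} (j k : Fin (suc n)) = Average (1/n (suc n)) (deviation j k)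

U : ∀ {n} → ℝ → Matrix n
U t j k = fromℝ (real (evolution j k (mkReal t)))

mixing-realPart : ∀ {n} (j k : Fin n) → RealPart (λ t → (U t ∘ᴹ conjᴹ (U t)) j k) (λ t → square (evolution j k t))
mixing-realPart j k = record
  { re-≗ = λ t p → solve 1 (λ x → x :* x :- con 0ℚ :* (:- con 0ℚ) := x :* x) refl (at (evolution j k (mkReal t)) p)
  ; im-≗ = λ t p → solve 1 (λ x → x :* (:- con 0ℚ) :+ con 0ℚ :* x := con 0ℚ) refl (at (evolution j k (mkReal t)) p)
  }

<ℝ⇒≲ : ∀ T → 0ℝ <ℝ T → 0ᴿ ≲ mkReal T
<ℝ⇒≲ T (c , 0<c , N , c≤T) = Eventually-≲ {0ᴿ} {mkReal T}
  (N , λ p N≤p → ℚ.≤-trans (p≤p+ε {0ℚ} 0<c) (c≤T p N≤p))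

mixing-integral : ∀ {n} T → 0ℝ <ℝ T → (j k : Fin (suc n)) →
  HasIntegral (λ t → (U t ∘ᴹ conjᴹ (U t)) j k) 0ℝ T (fromℝ (real (Mean.integral j k (mkReal T))))
mixing-integral T 0<T j k = fundamental-theorem (mixing-realPart j k)
  (Mean.antiderivative-differentiable j k) T (<ℝ⇒≲ T 0<T)

mixing-limit : ∀ {n} (j k : Fin (suc n)) ε → 0ℚ ℚ.< ε → ∃ λ T₀ → ∀ T (0<T : 0ℝ <ℝ T) → T₀ ≤ℝ T →
  Modulus≤ ε (fromℝ (inverse T 0<T) *ℂ fromℝ (real (Mean.integral j k (mkReal T))) -ℂ 1/n·J (suc n) j k)
mixing-limit {n} j k ε 0<ε = let T₀ , close = Mean.integral-average j k ε 0<ε in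
  T₀ , λ T 0<T T₀≤T → Modulus-intro
    {z = fromℝ (inverse T 0<T) *ℂ fromℝ (real (Mean.integral j k (mkReal T))) -ℂ 1/n·J (suc n) j k}
    (∣∣-resp-≗ (close T 0<T T₀≤T) λ p →
      solve 3 (λ i x c → (i :* x :- con 0ℚ :* con 0ℚ) :- (c :* con 1ℚ :- con 0ℚ :* con 0ℚ) := i :* x :- c) refl
        (recip (seq T p)) (at (Mean.integral j k (mkReal T)) p) (1/n (suc n)))
    (∣∣-zero λ p →
      solve 3 (λ i x c → (i :* con 0ℚ :+ con 0ℚ :* x) :- (c :* con 0ℚ :+ con 0ℚ :* con 1ℚ) := con 0ℚ) refl
        (recip (seq T p)) (at (Mean.integral j k (mkReal T)) p) (1/n (suc n)))

corollary6 : (n : ℕ) → 2 ≤ n → AverageUniformMixing (transitiveTournament n)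
corollary6 (suc n) _ = record
  { U     = U
  ; isU   = λ t → Exponential.isMatrixExp t
  ; ∫M    = λ T j k → fromℝ (real (Mean.integral j k (mkReal T)))
  ; is∫M  = mixing-integral
  ; limit = mixing-limit
  }
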